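{- Let $\alpha=(a_1,\ldots,a_k)$ be a composition of a non-negative integer $n$. Then \[(\zeta^{ -1})_-(F_\alpha)=\frac{(-1)^{n+p_-(\tilde\alpha)}}{2^{2\lfloor n/2\rfloor}}\,C\bigl(p_-(\tilde\alpha),\lfloor n/2\rfloor-p_-(\tilde\alpha)\bigr),\] \[(\zeta^{ -1})_+(F_\alpha)=\begin{cases}\dfrac{(-1)^{p_+(\alpha')}}{2^n}\,C\bigl(p_+(\alpha'),n/2-p_+(\alpha')\bigr)&\text{if } n\text{ is even},\\0&\text{if } n\text{ is odd.}\end{cases}\]
   Context: $\Bbbk$ is a field of characteristic $\neq2$. A composition $\alpha=(a_1,\ldots,a_k)$ of $n$ is a sequence of positive integers with sum $n$; its descent set is $D(\alpha)=\{a_1,a_1+a_2,\ldots,a_1+\cdots+a_{k-1}\}\subseteq\{1,\ldots,n-1\}$, which determines $\alpha$. $\tilde\alpha=(a_k,\ldots,a_1)$ is the reversal, and the conjugate $\alpha'$ is the composition of $n$ with $D(\alpha')=\{1,\ldots,n-1\}\setminus\{n-d: d\in D(\alpha)\}$ (its ribbon diagram is the reflection of that of $\alpha$ in the line $y=x$). Statistics: $p_-(\alpha)=\#\{i\ne k: a_i>1\}$; $p_+(\alpha)=1+\#\{i\ne1,k: a_i>1\}$ if $k>1$, $p_+(\alpha)=0$ if $k\le1$. ${\mathcal{Q}Sym}$ is the graded connected Hopf algebra of quasi-symmetric functions over $\Bbbk$, with monomial basis $M_\alpha=\sum_{i_1<\cdots<i_k}x_{i_1}^{a_1}\cdots x_{i_k}^{a_k}$,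 fundamental basis $F_\alpha=\sum_{\beta\ge\alpha}M_\beta$ ($\beta\ge\alpha$: $\beta$ refines $\alpha$), ordinary product, coproduct $\Delta(M_\alpha)=\sum_{i=0}^kM_{(a_1,\ldots,a_i)}\otimes M_{(a_{i+1},\ldots,a_k)}$. Convolution $\rho\psi=m\circ(\rho\otimes\psi)\circ\Delta$; characters (algebra morphisms to $\Bbbk$) form a group under convolution. For a functional $\varphi$, $\bar\varphi(h)=(-1)^n\varphi(h)$ on homogeneous $h$ of degree $n$; $\varphi$ is even if $\bar\varphi=\varphi$ and odd if $\bar\varphi=\varphi^{ -1}$. Every character factors uniquely as $\varphi=\varphi_+\varphi_-$ with $\varphi_+$ even and $\varphi_-$ odd characters. $\zeta(f)=f(1,0,0,\ldots)$ is the universal character ($\zeta(F_\alpha)=1$ if $\alpha=()$ or $\alpha=(n)$, else $0$), $\zeta^{ -1}$ its convolution inverse, and $(\zeta^{ -1})_\pm$ the even and odd parts of $\zeta^{ -1}$. $C(p,q)=\frac{(2p)!(2q)!}{p!(p+q)!q!}$. -}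

module Defs where

open import Level using (Level; _⊔_)
open import Algebra.Apartness.Bundles using (HeytingField; HeytingCommutativeRing)
open import Algebra.Bundles using (CommutativeRing)
open import Algebra.Bundles.Raw using (RawRing)
open import Algebra.Module.Bundles.Raw using (RawLeftModule)
import Algebra.Module.Construct.TensorUnit as TensorUnit
open import Algebra.Module.Morphism.Structures using (module LeftModuleMorphisms)
open import Algebra.Morphism.Structures using (module RingMorphisms)
import Algebra.Properties.Ring as RingProperties
import Algebra.Properties.Semiring.Exp as Exponentiation
import Algebra.Properties.Semiring.Mult as Multiples
open import Data.Bool.Base using (true; false; if_then_else_)
open import Data.Empty using (⊥-elim)
open import Data.List.Base using
  (List; []; _∷_; _++_; map; concatMap; filter; foldr; length; take; drop; upTo; applyUpTo; [_])
open import Data.List.Membership.Propositional using (_∈_)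
open import Data.List.Membership.Propositional.Properties using (∈-map⁺; ∈-map⁻)
open import Data.List.Properties using (≡-dec; upTo-∷ʳ)
open import Data.List.Relation.Unary.All using (All; []; _∷_; all?)
open import Data.List.Relation.Unary.Any using (here; there)
import Data.List.Membership.DecPropositional as DecMembership
open import Data.Nat.Base as ℕ using (ℕ; zero; suc; z≤n; s≤s; _∸_; _!)
import Data.Nat.DivMod as ℕ using (_/_)
open import Data.Nat.ListAction using (sum)
import Data.Nat.Properties as ℕ
open import Data.Product.Base using (_×_; _,_; proj₁; proj₂)
open import Data.Sum.Base using (_⊎_; inj₁; inj₂)
open import Function.Base using (_∘_)
open import Function.Bundles using (_⇔_; mk⇔; Equivalence)
open import Relation.Binary.PropositionalEquality as ≡ using (_≡_; refl; cong; subst)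
import Relation.Binary.Reasoning.Setoid as SetoidReasoning
open import Relation.Nullary.Decidable using (Dec; does; yes; no; ¬?)
open import Relation.Nullary.Negation using (¬_)
open import Relation.Unary using (Decidable; Pred)

open DecMembership ℕ._≟_ using (_∈?_)

infix 4 _⊨_

_⊨_ : List ℕ → ℕ → Set
α ⊨ n = All (0 ℕ.<_) α × sum α ≡ n

-- D(a₁,…,aₖ) = {a₁, a₁+a₂, …, a₁+⋯+aₖ₋₁}
D : List ℕ → List ℕ
D []          = []
D (a ∷ [])    = []
D (a ∷ b ∷ α) = a ∷ map (a ℕ.+_) (D (b ∷ α))

-- β ≥ α, for compositions of the same integer
_Refines_ : List ℕ → List ℕ → Set
β Refines α = All (_∈ D β) (D α)

_refines?_ : ∀ β α → Dec (β Refines α)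
β refines? α = all? (_∈? D β) (D α)

bump : List ℕ → List ℕ
bump []      = []
bump (a ∷ α) = suc a ∷ α

compositions : ℕ → List (List ℕ)
compositions zero          = [ [] ]
compositions (suc zero)    = [ [ 1 ] ]
compositions (suc (suc n)) =
  concatMap (λ β → (1 ∷ β) ∷ bump β ∷ []) (compositions (suc n))

-- The composition of n whose descent set is {1 ≤ d < n : P d}; see ∈-D-fromDescents.
fromDescents : ∀ {p} {P : Pred ℕ p} → Decidable P → ℕ → List ℕ
fromDescents P? zero          = []
fromDescents P? (suc zero)    = [ 1 ]
fromDescents P? (suc (suc n)) =
  if does (P? 1) then 1 ∷ fromDescents (P? ∘ suc) (suc n)
                 else bump (fromDescents (P? ∘ suc) (suc n))

-- α′, for α a composition of n; see ∈-D-conjugate.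
conjugate : ℕ → List ℕ → List ℕ
conjugate n α = fromDescents (λ d → ¬? (n ∸ d ∈? D α)) n

count>1 : List ℕ → ℕ
count>1 α = length (filter (1 ℕ.<?_) α)

p₋ : List ℕ → ℕ
p₋ α = count>1 (take (length α ∸ 1) α)

p₊ : List ℕ → ℕ
p₊ []          = 0
p₊ (a ∷ [])    = 0
p₊ (a ∷ b ∷ α) = suc (count>1 (take (length α) (b ∷ α)))

-- The division is exact: these quotients are integers.
C : ℕ → ℕ → ℕ
C p q = ℕ._/_ ((2 ℕ.* p) ! ℕ.* (2 ℕ.* q) !) (p ! ℕ.* (p ℕ.+ q) ! ℕ.* q !)
          {{ℕ.m*n≢0 _ _ {{p ℕ.!* (p ℕ.+ q) !≢0}} {{q ℕ.!≢0}}}}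

⊨-1∷ : ∀ {α n} → α ⊨ n → 1 ∷ α ⊨ suc n
⊨-1∷ (pos , tot) = s≤s z≤n ∷ pos , cong suc tot

⊨-bump : ∀ {α n} → α ⊨ suc n → bump α ⊨ suc (suc n)
⊨-bump {a ∷ α} (p ∷ pos , tot) = s≤s z≤n ∷ pos , cong suc tot

compositions-⊨ : ∀ n → All (_⊨ n) (compositions n)
compositions-⊨ zero          = ([] , refl) ∷ []
compositions-⊨ (suc zero)    = (s≤s z≤n ∷ [] , refl) ∷ []
compositions-⊨ (suc (suc n)) = go (compositions-⊨ (suc n))
  where
  go : ∀ {βs} → All (_⊨ suc n) βs →
       All (_⊨ suc (suc n)) (concatMap (λ β → (1 ∷ β) ∷ bump β ∷ []) βs)
  go []       = []
  go (p ∷ ps) = ⊨-1∷ p ∷ ⊨-bump p ∷ go ps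

fromDescents-⊨ : ∀ {p} {P : Pred ℕ p} (P? : Decidable P) n → fromDescents P? n ⊨ n
fromDescents-⊨ P? zero       = [] , refl
fromDescents-⊨ P? (suc zero) = s≤s z≤n ∷ [] , refl
fromDescents-⊨ P? (suc (suc n)) with does (P? 1) | fromDescents-⊨ (P? ∘ suc) (suc n)
... | true  | r⊨ = ⊨-1∷ r⊨
... | false | r⊨ = ⊨-bump r⊨

D-1∷ : ∀ {n} α → α ⊨ suc n → D (1 ∷ α) ≡ 1 ∷ map suc (D α)
D-1∷ (a ∷ α) _ = refl

D-bump : ∀ α → D (bump α) ≡ map suc (D α)
D-bump []          = refl
D-bump (a ∷ [])    = refl
D-bump (a ∷ b ∷ α) = cong (suc a ∷_) (go (D (b ∷ α)))
  where
  go : ∀ xs → map (suc a ℕ.+_) xs ≡ map suc (map (a ℕ.+_) xs)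
  go []       = refl
  go (x ∷ xs) = cong (suc (a ℕ.+ x) ∷_) (go xs)

∈-D-fromDescents : ∀ {p} {P : Pred ℕ p} (P? : Decidable P) n d →
                   d ∈ D (fromDescents P? n) ⇔ (0 ℕ.< d × d ℕ.< n × P d)
∈-D-fromDescents P? zero d = mk⇔ (λ ()) λ { (_ , () , _) }
∈-D-fromDescents P? (suc zero) zero = mk⇔ (λ ()) λ { (() , _) }
∈-D-fromDescents P? (suc zero) (suc d) = mk⇔ (λ ()) λ { (_ , s≤s () , _) }
∈-D-fromDescents {P = P} P? (suc (suc n)) d with P? 1
... | yes P1 = subst (λ X → d ∈ X ⇔ (0 ℕ.< d × d ℕ.< suc (suc n) × P d))
                     (≡.sym (D-1∷ r (fromDescents-⊨ (P? ∘ suc) (suc n)))) (mk⇔ to from)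
  where
  r = fromDescents (P? ∘ suc) (suc n)
  to : d ∈ 1 ∷ map suc (D r) → 0 ℕ.< d × d ℕ.< suc (suc n) × P d
  to (here refl) = s≤s z≤n , s≤s (s≤s z≤n) , P1
  to (there d∈) with ∈-map⁻ suc d∈
  ... | d′ , d′∈ , refl with Equivalence.to (∈-D-fromDescents (P? ∘ suc) (suc n) d′) d′∈
  ...   | _ , d′<n , Pd = s≤s z≤n , s≤s d′<n , Pd
  from : 0 ℕ.< d × d ℕ.< suc (suc n) × P d → d ∈ 1 ∷ map suc (D r)
  from (s≤s {n = zero} _ , _ , _) = here refl
  from (s≤s {n = suc d′} _ , s≤s d<n , Pd) =
    there (∈-map⁺ suc (Equivalence.from (∈-D-fromDescents (P? ∘ suc) (suc n) (suc d′))
                         (s≤s z≤n , d<n , Pd)))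
... | no ¬P1 = subst (λ X → d ∈ X ⇔ (0 ℕ.< d × d ℕ.< suc (suc n) × P d))
                     (≡.sym (D-bump r)) (mk⇔ to from)
  where
  r = fromDescents (P? ∘ suc) (suc n)
  to : d ∈ map suc (D r) → 0 ℕ.< d × d ℕ.< suc (suc n) × P d
  to d∈ with ∈-map⁻ suc d∈
  ... | d′ , d′∈ , refl with Equivalence.to (∈-D-fromDescents (P? ∘ suc) (suc n) d′) d′∈
  ...   | _ , d′<n , Pd = s≤s z≤n , s≤s d′<n , Pd
  from : 0 ℕ.< d × d ℕ.< suc (suc n) × P d → d ∈ map suc (D r)
  from (s≤s {n = zero} _ , _ , Pd) = ⊥-elim (¬P1 Pd)
  from (s≤s {n = suc d′} _ , s≤s d<n , Pd) =
    ∈-map⁺ suc (Equivalence.from (∈-D-fromDescents (P? ∘ suc) (suc n) (suc d′))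
                  (s≤s z≤n , d<n , Pd))

conjugate-⊨ : ∀ n α → conjugate n α ⊨ n
conjugate-⊨ n α = fromDescents-⊨ (λ d → ¬? (n ∸ d ∈? D α)) n

∈-D-conjugate : ∀ n α d →
                d ∈ D (conjugate n α) ⇔ (0 ℕ.< d × d ℕ.< n × ¬ (n ∸ d ∈ D α))
∈-D-conjugate n α = ∈-D-fromDescents (λ d → ¬? (n ∸ d ∈? D α)) n

-- A list e of naturals stands for the monomial x₁^e₁ x₂^e₂ ⋯.
nonzeros : List ℕ → List ℕ
nonzeros = filter (0 ℕ.<?_)

sum-nonzeros : ∀ e → sum (nonzeros e) ≡ sum e
sum-nonzeros []          = refl
sum-nonzeros (zero  ∷ e) = sum-nonzeros e
sum-nonzeros (suc i ∷ e) = cong (suc i ℕ.+_) (sum-nonzeros e)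

nonzeros-idem : ∀ e → nonzeros (nonzeros e) ≡ nonzeros e
nonzeros-idem []          = refl
nonzeros-idem (zero  ∷ e) = nonzeros-idem e
nonzeros-idem (suc i ∷ e) = cong (suc i ∷_) (nonzeros-idem e)

nonzeros-∷ : ∀ i e → nonzeros (i ∷ nonzeros e) ≡ nonzeros (i ∷ e)
nonzeros-∷ zero    e = nonzeros-idem e
nonzeros-∷ (suc i) e = cong (suc i ∷_) (nonzeros-idem e)

-- (a₁,…,aₖ) ↦ all ((a₁,…,aᵢ) , (aᵢ₊₁,…,aₖ)) with 0 ≤ i ≤ k
cuts : List ℕ → List (List ℕ × List ℕ)
cuts α = map (λ i → take i α , drop i α) (upTo (suc (length α)))

-- In a Heyting field, # is the positive form of inequality.
CharNot2 : ∀ {c ℓ₁ ℓ₂} → HeytingField c ℓ₁ ℓ₂ → Set ℓ₂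
CharNot2 K = (1# + 1#) # 0#
  where open HeytingField K

module QuasiSymmetric {c ℓ₁ ℓ₂ : Level} (K : HeytingField c ℓ₁ ℓ₂) (2#0 : CharNot2 K) where

  open HeytingField K using (#⇒invertible; heytingCommutativeRing)

  𝕜 : CommutativeRing c ℓ₁
  𝕜 = HeytingCommutativeRing.commutativeRing heytingCommutativeRing

  open CommutativeRing 𝕜 public
    hiding (refl; sym; trans; rawRing)
  open CommutativeRing 𝕜 using (rawRing)
    renaming (refl to ≈-refl; sym to ≈-sym; trans to ≈-trans)
  open RingProperties ring using (-‿distribʳ-*; -0#≈0#; -‿+-comm; -1*x≈-x)
  open Exponentiation semiring public using (_^_)
  open Exponentiation semiring using (^-congʳ)
  open Multiples semiring public using () renaming (_×_ to _×ₖ_)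
  open SetoidReasoning setoid

  -- #⇒invertible inverts the difference 2 - 0.
  ½ : Carrier
  ½ = proj₁ (#⇒invertible 2#0)

  2*½≈1 : (1# + 1#) * ½ ≈ 1#
  2*½≈1 = begin
    (1# + 1#) * ½         ≈⟨ *-congʳ (≈-sym (≈-trans (+-congˡ -0#≈0#) (+-identityʳ _))) ⟩
    (1# + 1# - 0#) * ½    ≈⟨ proj₂ (proj₂ (#⇒invertible 2#0)) ⟩
    1#                    ∎

  infixl 7 _/2^_

  _/2^_ : Carrier → ℕ → Carrier
  x /2^ m = x * ½ ^ m

  ι : ℕ → Carrier
  ι n = n ×ₖ 1#

  [-1]^_ : ℕ → Carrier
  [-1]^ n = (- 1#) ^ n

  ∑ : ∀ {a} {A : Set a} → List A → (A → Carrier) → Carrier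
  ∑ xs f = foldr (λ x s → f x + s) 0# xs

  module _ {a} {A : Set a} where

    ∑-cong : ∀ (xs : List A) {f g} → (∀ x → f x ≈ g x) → ∑ xs f ≈ ∑ xs g
    ∑-cong []       f≈g = ≈-refl
    ∑-cong (x ∷ xs) f≈g = +-cong (f≈g x) (∑-cong xs f≈g)

    ∑-zero : ∀ {xs : List A} {f} → All (λ x → f x ≈ 0#) xs → ∑ xs f ≈ 0#
    ∑-zero []       = ≈-refl
    ∑-zero (p ∷ ps) = ≈-trans (+-cong p (∑-zero ps)) (+-identityˡ 0#)

    ∑-+ : ∀ (xs : List A) f g → ∑ xs (λ x → f x + g x) ≈ ∑ xs f + ∑ xs g
    ∑-+ []       f g = ≈-sym (+-identityˡ 0#)
    ∑-+ (x ∷ xs) f g = begin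
      (f x + g x) + ∑ xs (λ x → f x + g x)  ≈⟨ +-congˡ (∑-+ xs f g) ⟩
      (f x + g x) + (∑ xs f + ∑ xs g)       ≈⟨ +-assoc _ _ _ ⟩
      f x + (g x + (∑ xs f + ∑ xs g))       ≈⟨ +-congˡ (≈-sym (+-assoc _ _ _)) ⟩
      f x + ((g x + ∑ xs f) + ∑ xs g)       ≈⟨ +-congˡ (+-congʳ (+-comm _ _)) ⟩
      f x + ((∑ xs f + g x) + ∑ xs g)       ≈⟨ +-congˡ (+-assoc _ _ _) ⟩
      f x + (∑ xs f + (g x + ∑ xs g))       ≈⟨ ≈-sym (+-assoc _ _ _) ⟩
      (f x + ∑ xs f) + (g x + ∑ xs g)       ∎

    ∑-*ˡ : ∀ (xs : List A) k f → ∑ xs (λ x → k * f x) ≈ k * ∑ xs f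
    ∑-*ˡ []       k f = ≈-sym (zeroʳ k)
    ∑-*ˡ (x ∷ xs) k f = ≈-trans (+-congˡ (∑-*ˡ xs k f)) (≈-sym (distribˡ k _ _))

    ∑-++ : ∀ (xs ys : List A) f → ∑ (xs ++ ys) f ≈ ∑ xs f + ∑ ys f
    ∑-++ []       ys f = ≈-sym (+-identityˡ _)
    ∑-++ (x ∷ xs) ys f = ≈-trans (+-congˡ (∑-++ xs ys f)) (≈-sym (+-assoc _ _ _))

    ∑-map : ∀ {b} {B : Set b} (h : B → A) xs f → ∑ (map h xs) f ≈ ∑ xs (f ∘ h)
    ∑-map h []       f = ≈-refl
    ∑-map h (x ∷ xs) f = +-congˡ (∑-map h xs f)

    ∑-concatMap : ∀ {b} {B : Set b} (h : B → List A) xs f →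
                  ∑ (concatMap h xs) f ≈ ∑ xs (λ x → ∑ (h x) f)
    ∑-concatMap h []       f = ≈-refl
    ∑-concatMap h (x ∷ xs) f =
      ≈-trans (∑-++ (h x) (concatMap h xs) f) (+-congˡ (∑-concatMap h xs f))

  ∑-extend : ∀ {d N} (h : ℕ → Carrier) → (∀ m → d ℕ.< m → h m ≈ 0#) → d ℕ.≤′ N →
             ∑ (upTo (suc d)) h ≈ ∑ (upTo (suc N)) h
  ∑-extend h h≈0 (ℕ.≤′-reflexive refl) = ≈-refl
  ∑-extend {d} {suc N} h h≈0 (ℕ.≤′-step d≤N) = begin
    ∑ (upTo (suc d)) h                     ≈⟨ ∑-extend h h≈0 d≤N ⟩
    ∑ (upTo (suc N)) h                     ≈⟨ ≈-sym (+-identityʳ _) ⟩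
    ∑ (upTo (suc N)) h + 0#
      ≈⟨ +-congˡ (≈-sym (∑-zero {f = h} (h≈0 (suc N) (s≤s (ℕ.≤′⇒≤ d≤N)) ∷ []))) ⟩
    ∑ (upTo (suc N)) h + ∑ [ suc N ] h     ≈⟨ ≈-sym (∑-++ (upTo (suc N)) [ suc N ] h) ⟩
    ∑ (upTo (suc N) ++ [ suc N ]) h        ≡⟨ cong (λ xs → ∑ xs h) (upTo-∷ʳ (suc N)) ⟩
    ∑ (upTo (suc (suc N))) h               ∎

  -- A formal power series in x₁, x₂, … is given by its coefficients.  Quasi-symmetry
  -- says that the coefficient of x_{i₁}^a₁ ⋯ x_{iₖ}^aₖ (i₁ < ⋯ < iₖ, all aⱼ > 0) depends
  -- only on (a₁,…,aₖ), and also makes trailing zero exponents irrelevant.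
  record QSym : Set (c ⊔ ℓ₁) where
    field
      coeff          : List ℕ → Carrier
      quasiSymmetric : ∀ e → coeff e ≈ coeff (nonzeros e)
      bound          : ℕ
      bounded        : ∀ e → bound ℕ.< sum e → coeff e ≈ 0#

  open QSym public

  infix 4 _≈ᑫ_

  _≈ᑫ_ : QSym → QSym → Set ℓ₁
  f ≈ᑫ g = ∀ e → coeff f e ≈ coeff g e

  0ᑫ : QSym
  0ᑫ = record
    { coeff          = λ _ → 0#
    ; quasiSymmetric = λ _ → ≈-refl
    ; bound          = 0
    ; bounded        = λ _ _ → ≈-refl
    }

  infixl 6 _+ᑫ_

  _+ᑫ_ : QSym → QSym → QSym
  f +ᑫ g = record
    { coeff          = λ e → coeff f e + coeff g e
    ; quasiSymmetric = λ e → +-cong (quasiSymmetric f e) (quasiSymmetric g e)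
    ; bound          = bound f ℕ.⊔ bound g
    ; bounded        = λ e d<e → ≈-trans
        (+-cong (bounded f e (ℕ.≤-<-trans (ℕ.m≤m⊔n (bound f) (bound g)) d<e))
                (bounded g e (ℕ.≤-<-trans (ℕ.m≤n⊔m (bound f) (bound g)) d<e)))
        (+-identityˡ 0#)
    }

  infixr 7 _·ᑫ_

  _·ᑫ_ : Carrier → QSym → QSym
  k ·ᑫ f = record
    { coeff          = λ e → k * coeff f e
    ; quasiSymmetric = λ e → *-congˡ (quasiSymmetric f e)
    ; bound          = bound f
    ; bounded        = λ e d<e → ≈-trans (*-congˡ (bounded f e d<e)) (zeroʳ k)
    }

  -ᑫ_ : QSym → QSym
  -ᑫ f = (- 1#) ·ᑫ f

  -- Coefficient of the monomial e in a product of power series: the sum of f(u) g(v)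
  -- over all u, v with u + v = e.
  cauchy : (f g : List ℕ → Carrier) → List ℕ → Carrier
  cauchy f g []      = f [] * g []
  cauchy f g (m ∷ e) =
    ∑ (upTo (suc m)) (λ i → cauchy (λ u → f (i ∷ u)) (λ v → g (m ∸ i ∷ v)) e)

  cauchy-cong : ∀ {f f′ g g′} → (∀ e → f e ≈ f′ e) → (∀ e → g e ≈ g′ e) →
                ∀ e → cauchy f g e ≈ cauchy f′ g′ e
  cauchy-cong f≈ g≈ []      = *-cong (f≈ []) (g≈ [])
  cauchy-cong f≈ g≈ (m ∷ e) = ∑-cong (upTo (suc m))
    (λ i → cauchy-cong (λ u → f≈ (i ∷ u)) (λ v → g≈ (m ∸ i ∷ v)) e)

  IsQuasiSymmetric : (List ℕ → Carrier) → Set ℓ₁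
  IsQuasiSymmetric f = ∀ e → f e ≈ f (nonzeros e)

  ∷-quasiSymmetric : ∀ {f} → IsQuasiSymmetric f → ∀ i → IsQuasiSymmetric (λ u → f (i ∷ u))
  ∷-quasiSymmetric {f} qf i e = begin
    f (i ∷ e)                      ≈⟨ qf (i ∷ e) ⟩
    f (nonzeros (i ∷ e))           ≡⟨ cong f (nonzeros-∷ i e) ⟨
    f (nonzeros (i ∷ nonzeros e))  ≈⟨ qf (i ∷ nonzeros e) ⟨
    f (i ∷ nonzeros e)             ∎

  0∷-quasiSymmetric : ∀ {f} → IsQuasiSymmetric f → ∀ e → f (0 ∷ e) ≈ f e
  0∷-quasiSymmetric qf e = ≈-trans (qf (0 ∷ e)) (≈-sym (qf e))

  cauchy-quasiSymmetric : ∀ {f g} → IsQuasiSymmetric f → IsQuasiSymmetric g →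
                          IsQuasiSymmetric (cauchy f g)
  cauchy-quasiSymmetric qf qg [] = ≈-refl
  cauchy-quasiSymmetric {f} {g} qf qg (zero ∷ e) = begin
    cauchy (λ u → f (0 ∷ u)) (λ v → g (0 ∷ v)) e + 0#  ≈⟨ +-identityʳ _ ⟩
    cauchy (λ u → f (0 ∷ u)) (λ v → g (0 ∷ v)) e
      ≈⟨ cauchy-cong (0∷-quasiSymmetric qf) (0∷-quasiSymmetric qg) e ⟩
    cauchy f g e                                       ≈⟨ cauchy-quasiSymmetric qf qg e ⟩
    cauchy f g (nonzeros e)                            ∎
  cauchy-quasiSymmetric qf qg (suc m ∷ e) = ∑-cong (upTo (suc (suc m)))
    (λ i → cauchy-quasiSymmetric (∷-quasiSymmetric qf i) (∷-quasiSymmetric qg (suc m ∸ i)) e)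

  +-<-split : ∀ {a b s t} → a ℕ.+ b ℕ.< s ℕ.+ t → a ℕ.< s ⊎ b ℕ.< t
  +-<-split {a} {b} {s} {t} lt with a ℕ.<? s
  ... | yes a<s = inj₁ a<s
  ... | no  a≮s = inj₂ (ℕ.+-cancelˡ-< a b t
                    (ℕ.<-≤-trans lt (ℕ.+-monoˡ-≤ t (ℕ.≮⇒≥ a≮s))))

  all-upTo : ∀ {p} {P : Pred ℕ p} m → (∀ i → i ℕ.≤ m → P i) → All P (upTo (suc m))
  all-upTo {P = P} m h = go (suc m) (λ i → i) (λ { i (s≤s i≤m) → h i i≤m })
    where
    go : ∀ k (φ : ℕ → ℕ) → (∀ i → i ℕ.< k → P (φ i)) → All P (applyUpTo φ k)
    go zero    φ hφ = []
    go (suc k) φ hφ = hφ 0 (s≤s z≤n) ∷ go k (φ ∘ suc) (λ i i<k → hφ (suc i) (s≤s i<k))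

  cauchy-bounded : ∀ {f g} a b s t →
    (∀ e → a ℕ.< s ℕ.+ sum e → f e ≈ 0#) → (∀ e → b ℕ.< t ℕ.+ sum e → g e ≈ 0#) →
    ∀ e → a ℕ.+ b ℕ.< (s ℕ.+ t) ℕ.+ sum e → cauchy f g e ≈ 0#
  cauchy-bounded a b s t bf bg [] lt
    with +-<-split {a} {b} {s} {t} (subst (a ℕ.+ b ℕ.<_) (ℕ.+-identityʳ (s ℕ.+ t)) lt)
  ... | inj₁ a<s = ≈-trans (*-congʳ (bf [] (subst (a ℕ.<_) (≡.sym (ℕ.+-identityʳ s)) a<s))) (zeroˡ _)
  ... | inj₂ b<t = ≈-trans (*-congˡ (bg [] (subst (b ℕ.<_) (≡.sym (ℕ.+-identityʳ t)) b<t))) (zeroʳ _)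
  cauchy-bounded a b s t bf bg (m ∷ e) lt = ∑-zero (all-upTo m λ i i≤m →
    cauchy-bounded a b (s ℕ.+ i) (t ℕ.+ (m ∸ i))
      (λ u p → bf (i ∷ u) (subst (a ℕ.<_) (ℕ.+-assoc s i (sum u)) p))
      (λ v p → bg (m ∸ i ∷ v) (subst (b ℕ.<_) (ℕ.+-assoc t (m ∸ i) (sum v)) p))
      e (subst (a ℕ.+ b ℕ.<_) (regroup i i≤m) lt))
    where
    regroup : ∀ i → i ℕ.≤ m →
      (s ℕ.+ t) ℕ.+ (m ℕ.+ sum e) ≡ ((s ℕ.+ i) ℕ.+ (t ℕ.+ (m ∸ i))) ℕ.+ sum e
    regroup i i≤m = ≡.trans (≡.sym (ℕ.+-assoc (s ℕ.+ t) m (sum e))) (cong (ℕ._+ sum e)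
      (≡.trans (cong ((s ℕ.+ t) ℕ.+_) (≡.sym (ℕ.m+[n∸m]≡n i≤m)))
               (interchange s t i (m ∸ i))))
      where
      open import Algebra.Properties.CommutativeSemigroup ℕ.+-commutativeSemigroup
        using (interchange)

  infixl 7 _*ᑫ_

  _*ᑫ_ : QSym → QSym → QSym
  f *ᑫ g = record
    { coeff          = cauchy (coeff f) (coeff g)
    ; quasiSymmetric = cauchy-quasiSymmetric (quasiSymmetric f) (quasiSymmetric g)
    ; bound          = bound f ℕ.+ bound g
    ; bounded        = cauchy-bounded (bound f) (bound g) 0 0 (bounded f) (bounded g)
    }

  _≟ᶜ_ : (α β : List ℕ) → Dec (α ≡ β)
  _≟ᶜ_ = ≡-dec ℕ._≟_

  -- M_α, for α without zero entries
  M : List ℕ → QSym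
  M α = record
    { coeff          = indicator ∘ nonzeros
    ; quasiSymmetric = λ e → reflexive (cong indicator (≡.sym (nonzeros-idem e)))
    ; bound          = sum α
    ; bounded        = vanishes
    }
    where
    indicator : List ℕ → Carrier
    indicator β = if does (β ≟ᶜ α) then 1# else 0#

    vanishes : ∀ e → sum α ℕ.< sum e → indicator (nonzeros e) ≈ 0#
    vanishes e lt with nonzeros e ≟ᶜ α
    ... | yes eq = ⊥-elim (ℕ.<-irrefl (≡.trans (cong sum (≡.sym eq)) (sum-nonzeros e)) lt)
    ... | no  _  = ≈-refl

  1ᑫ : QSym
  1ᑫ = M []

  -- F_α is the sum of the M_β over the compositions β of |α| that refine α.
  F : List ℕ → QSym
  F α = foldr (λ β f → M β +ᑫ f) 0ᑫ (filter (_refines? α) (compositions (sum α)))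

  QSym-rawLeftModule : RawLeftModule Carrier (c ⊔ ℓ₁) ℓ₁
  QSym-rawLeftModule = record
    { _≈ᴹ_ = _≈ᑫ_ ; _+ᴹ_ = _+ᑫ_ ; _*ₗ_ = _·ᑫ_ ; 0ᴹ = 0ᑫ ; -ᴹ_ = -ᑫ_ }

  QSym-rawRing : RawRing (c ⊔ ℓ₁) ℓ₁
  QSym-rawRing = record
    { _≈_ = _≈ᑫ_ ; _+_ = _+ᑫ_ ; _*_ = _*ᑫ_ ; -_ = -ᑫ_ ; 0# = 0ᑫ ; 1# = 1ᑫ }

  open LeftModuleMorphisms QSym-rawLeftModule (TensorUnit.rawLeftModule {R = rawRing})
    using (IsLeftModuleHomomorphism)
  open RingMorphisms QSym-rawRing rawRing using (IsRingHomomorphism)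

  record Functional : Set (c ⊔ ℓ₁) where
    infix 9 _⟨_⟩
    field
      _⟨_⟩     : QSym → Carrier
      isLinear : IsLeftModuleHomomorphism _⟨_⟩

    open IsLeftModuleHomomorphism isLinear public

  open Functional public using (_⟨_⟩)

  linear : (φ : QSym → Carrier) →
           (∀ {f g} → f ≈ᑫ g → φ f ≈ φ g) →
           (∀ f g → φ (f +ᑫ g) ≈ φ f + φ g) →
           (∀ k f → φ (k ·ᑫ f) ≈ k * φ f) →
           Functional
  linear φ φ-cong φ-+ φ-· = record
    { _⟨_⟩     = φ
    ; isLinear = record
      { +ᴹ-isGroupHomomorphism = record
        { isMonoidHomomorphism = record
          { isMagmaHomomorphism = record
            { isRelHomomorphism = record { cong = φ-cong }
            ; homo              = φ-+
            }
          ; ε-homo = ≈-trans (φ-cong (λ _ → ≈-sym (zeroˡ 0#)))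
                       (≈-trans (φ-· 0# 0ᑫ) (zeroˡ _))
          }
        ; ⁻¹-homo = λ f → ≈-trans (φ-· (- 1#) f) (-1*x≈-x (φ f))
        }
      ; *ₗ-homo = φ-·
      }
    }

  infix 4 _≋_

  _≋_ : Functional → Functional → Set (c ⊔ ℓ₁)
  φ ≋ ψ = ∀ f → φ ⟨ f ⟩ ≈ ψ ⟨ f ⟩

  IsCharacter : Functional → Set (c ⊔ ℓ₁)
  IsCharacter φ = IsRingHomomorphism (φ ⟨_⟩)

  -- A list of pairs (fᵢ , gᵢ) stands for the element Σ fᵢ ⊗ gᵢ of QSym ⊗ QSym.
  Tensor : Set (c ⊔ ℓ₁)
  Tensor = List (QSym × QSym)

  -- Expanding f = Σ_α coeff(f,α) M_α, where only α of size at most bound f matter,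
  -- this is the linear extension of Δ(M_α) = Σᵢ M_(a₁,…,aᵢ) ⊗ M_(aᵢ₊₁,…,aₖ).
  Δ : QSym → Tensor
  Δ f = concatMap (λ m → concatMap (λ α → map (λ (β , γ) → coeff f α ·ᑫ M β , M γ) (cuts α))
                                   (compositions m))
                  (upTo (suc (bound f)))

  m∘[_⊗_] : Functional → Functional → Tensor → Carrier
  m∘[ ρ ⊗ ψ ] t = ∑ t (λ (f , g) → ρ ⟨ f ⟩ * ψ ⟨ g ⟩)

  module Expand (ρ ψ : Functional) where

    onM : List ℕ → Carrier
    onM α = ∑ (cuts α) (λ (β , γ) → ρ ⟨ M β ⟩ * ψ ⟨ M γ ⟩)

    layer : QSym → ℕ → Carrier
    layer f m = ∑ (compositions m) (λ α → coeff f α * onM α)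

    upToDegree : ℕ → QSym → Carrier
    upToDegree N f = ∑ (upTo (suc N)) (layer f)

    conv : QSym → Carrier
    conv f = m∘[ ρ ⊗ ψ ] (Δ f)

    conv≈bound : ∀ f → conv f ≈ upToDegree (bound f) f
    conv≈bound f =
      ≈-trans (∑-concatMap ofDegree degrees value) (∑-cong degrees λ m →
      ≈-trans (∑-concatMap ofM (compositions m) value) (∑-cong (compositions m) λ α →
      ≈-trans (∑-map (scaled α) (cuts α) value)
      (≈-trans (∑-cong (cuts α) (scaled-value α))
               (∑-*ˡ (cuts α) (coeff f α) λ (β , γ) → ρ ⟨ M β ⟩ * ψ ⟨ M γ ⟩))))
      where
      degrees = upTo (suc (bound f))
      value : QSym × QSym → Carrier
      value (g , h) = ρ ⟨ g ⟩ * ψ ⟨ h ⟩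
      scaled : List ℕ → List ℕ × List ℕ → QSym × QSym
      scaled α (β , γ) = coeff f α ·ᑫ M β , M γ
      ofM : List ℕ → Tensor
      ofM α = map (scaled α) (cuts α)
      ofDegree : ℕ → Tensor
      ofDegree m = concatMap ofM (compositions m)
      scaled-value : ∀ α βγ → value (scaled α βγ) ≈
        coeff f α * (ρ ⟨ M (proj₁ βγ) ⟩ * ψ ⟨ M (proj₂ βγ) ⟩)
      scaled-value α (β , γ) =
        ≈-trans (*-congʳ (Functional.*ₗ-homo ρ (coeff f α) (M β))) (*-assoc _ _ _)

    layer-zero : ∀ f m → bound f ℕ.< m → layer f m ≈ 0#
    layer-zero f m d<m = ∑-zero (go (compositions-⊨ m))
      where
      go : ∀ {αs} → All (_⊨ m) αs → All (λ α → coeff f α * onM α ≈ 0#) αs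
      go [] = []
      go {α ∷ _} ((_ , tot) ∷ ps) = ≈-trans
        (*-congʳ (bounded f α (subst (bound f ℕ.<_) (≡.sym tot) d<m))) (zeroˡ _) ∷ go ps

    conv≈ : ∀ {N} f → bound f ℕ.≤ N → conv f ≈ upToDegree N f
    conv≈ f d≤N = ≈-trans (conv≈bound f)
      (∑-extend (layer f) (layer-zero f) (ℕ.≤⇒≤′ d≤N))

    conv-cong : ∀ {f g} → f ≈ᑫ g → conv f ≈ conv g
    conv-cong {f} {g} f≈g = begin
      conv f            ≈⟨ conv≈ f (ℕ.m≤m⊔n (bound f) (bound g)) ⟩
      upToDegree N f    ≈⟨ ∑-cong (upTo (suc N)) (λ m → ∑-cong (compositions m) λ α → *-congʳ (f≈g α)) ⟩
      upToDegree N g    ≈⟨ conv≈ g (ℕ.m≤n⊔m (bound f) (bound g)) ⟨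
      conv g            ∎
      where N = bound f ℕ.⊔ bound g

    conv-+ : ∀ f g → conv (f +ᑫ g) ≈ conv f + conv g
    conv-+ f g = begin
      conv (f +ᑫ g)             ≈⟨ conv≈bound (f +ᑫ g) ⟩
      upToDegree N (f +ᑫ g)
        ≈⟨ ∑-cong (upTo (suc N)) (λ m → ≈-trans
             (∑-cong (compositions m) λ α → distribʳ (onM α) (coeff f α) (coeff g α))
             (∑-+ (compositions m) _ _)) ⟩
      ∑ (upTo (suc N)) (λ m → layer f m + layer g m)
                                ≈⟨ ∑-+ (upTo (suc N)) (layer f) (layer g) ⟩
      upToDegree N f + upToDegree N g
        ≈⟨ +-cong (conv≈ f (ℕ.m≤m⊔n (bound f) (bound g)))
                  (conv≈ g (ℕ.m≤n⊔m (bound f) (bound g))) ⟨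
      conv f + conv g           ∎
      where N = bound f ℕ.⊔ bound g

    conv-· : ∀ k f → conv (k ·ᑫ f) ≈ k * conv f
    conv-· k f = begin
      conv (k ·ᑫ f)               ≈⟨ conv≈bound (k ·ᑫ f) ⟩
      upToDegree N (k ·ᑫ f)
        ≈⟨ ∑-cong (upTo (suc N)) (λ m → ≈-trans
             (∑-cong (compositions m) λ α → *-assoc k (coeff f α) (onM α))
             (∑-*ˡ (compositions m) k _)) ⟩
      ∑ (upTo (suc N)) (λ m → k * layer f m)
                                  ≈⟨ ∑-*ˡ (upTo (suc N)) k (layer f) ⟩
      k * upToDegree N f          ≈⟨ *-congˡ (conv≈bound f) ⟨
      k * conv f                  ∎
      where N = bound f

  infixl 7 _⋆_

  _⋆_ : Functional → Functional → Functional
  ρ ⋆ ψ = linear (λ f → m∘[ ρ ⊗ ψ ] (Δ f)) (λ {f} {g} → conv-cong {f} {g}) conv-+ conv-·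
    where open Expand ρ ψ

  -- The counit, which is the unit for convolution.
  ε : Functional
  ε = linear (λ f → coeff f []) (λ f≈g → f≈g []) (λ _ _ → ≈-refl) (λ _ _ → ≈-refl)

  IsInverse : Functional → Functional → Set (c ⊔ ℓ₁)
  IsInverse φ ψ = (φ ⋆ ψ ≋ ε) × (ψ ⋆ φ ≋ ε)

  module Evaluate where

    term : QSym → ℕ → Carrier
    term f m = coeff f [ m ]

    eval : QSym → Carrier
    eval f = ∑ (upTo (suc (bound f))) (term f)

    eval≈ : ∀ {N} f → bound f ℕ.≤ N → eval f ≈ ∑ (upTo (suc N)) (term f)
    eval≈ f d≤N = ∑-extend (term f)
      (λ m d<m → bounded f [ m ] (subst (bound f ℕ.<_) (≡.sym (ℕ.+-identityʳ m)) d<m))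
      (ℕ.≤⇒≤′ d≤N)

    eval-cong : ∀ {f g} → f ≈ᑫ g → eval f ≈ eval g
    eval-cong {f} {g} f≈g = begin
      eval f                      ≈⟨ eval≈ f (ℕ.m≤m⊔n (bound f) (bound g)) ⟩
      ∑ (upTo (suc N)) (term f)   ≈⟨ ∑-cong (upTo (suc N)) (λ m → f≈g [ m ]) ⟩
      ∑ (upTo (suc N)) (term g)   ≈⟨ eval≈ g (ℕ.m≤n⊔m (bound f) (bound g)) ⟨
      eval g                      ∎
      where N = bound f ℕ.⊔ bound g

    eval-+ : ∀ f g → eval (f +ᑫ g) ≈ eval f + eval g
    eval-+ f g = ≈-trans (∑-+ (upTo (suc (bound f ℕ.⊔ bound g))) (term f) (term g))
      (≈-sym (+-cong (eval≈ f (ℕ.m≤m⊔n (bound f) (bound g)))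
                     (eval≈ g (ℕ.m≤n⊔m (bound f) (bound g)))))

    eval-· : ∀ k f → eval (k ·ᑫ f) ≈ k * eval f
    eval-· k f = ∑-*ˡ (upTo (suc (bound f))) k (term f)

  -- ζ(f) = f(1,0,0,…): the sum of the coefficients of the powers x₁^m.
  ζ : Functional
  ζ = linear (λ f → ∑ (upTo (suc (bound f))) (λ m → coeff f [ m ]))
             (λ {f} {g} → eval-cong {f} {g}) eval-+ eval-·
    where open Evaluate

  sgn : QSym → QSym
  sgn f = record
    { coeff          = λ e → [-1]^ sum e * coeff f e
    ; quasiSymmetric = λ e → *-cong (^-congʳ (- 1#) (≡.sym (sum-nonzeros e))) (quasiSymmetric f e)
    ; bound          = bound f
    ; bounded        = λ e d<e → ≈-trans (*-congˡ (bounded f e d<e)) (zeroʳ _)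
    }

  -- φ̄; see bar-homogeneous.
  bar : Functional → Functional
  bar φ = linear (λ f → φ ⟨ sgn f ⟩)
    (λ f≈g → ⟦⟧-cong (λ e → *-congˡ (f≈g e)))
    (λ f g → ≈-trans (⟦⟧-cong (λ e → distribˡ _ _ _)) (+ᴹ-homo (sgn f) (sgn g)))
    (λ k f → ≈-trans
      (⟦⟧-cong (λ e → ≈-trans (≈-sym (*-assoc _ _ _))
                         (≈-trans (*-congʳ (*-comm _ _)) (*-assoc _ _ _))))
      (*ₗ-homo k (sgn f)))
    where open Functional φ hiding (_⟨_⟩)

  Homogeneous : ℕ → QSym → Set ℓ₁
  Homogeneous n h = ∀ e → ¬ (sum e ≡ n) → coeff h e ≈ 0#

  bar-homogeneous : ∀ φ n h → Homogeneous n h → bar φ ⟨ h ⟩ ≈ [-1]^ n * φ ⟨ h ⟩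
  bar-homogeneous φ n h hom = ≈-trans (⟦⟧-cong agree) (*ₗ-homo ([-1]^ n) h)
    where
    open Functional φ hiding (_⟨_⟩)
    agree : sgn h ≈ᑫ ([-1]^ n) ·ᑫ h
    agree e with sum e ℕ.≟ n
    ... | yes refl = ≈-refl
    ... | no  e≢n  = ≈-trans (≈-trans (*-congˡ (hom e e≢n)) (zeroʳ _))
                       (≈-sym (≈-trans (*-congˡ (hom e e≢n)) (zeroʳ _)))

  Even : Functional → Set (c ⊔ ℓ₁)
  Even φ = bar φ ≋ φ

  Odd : Functional → Set (c ⊔ ℓ₁)
  Odd φ = IsInverse φ (bar φ)

  record IsEvenOddFactorization (φ φ₊ φ₋ : Functional) : Set (c ⊔ ℓ₁) where
    field
      φ₊-character : IsCharacter φ₊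
      φ₋-character : IsCharacter φ₋
      φ₊-even      : Even φ₊
      φ₋-odd       : Odd φ₋
      factors      : φ ≋ φ₊ ⋆ φ₋

{-# OPTIONS --safe #-}
module Submission where

-- Encode a composition of n > 0 by its descent word of length n - 1.  On the fundamental basis
-- the coproduct is deconcatenation (cutting a ribbon before any box), so functionals multiply by
-- convolution of functions on words.  From ζ⁻¹ = φ₊φ₋ with φ₊ even and φ₋ odd one gets, with
-- ψ = φ̄₋, that ζφ₊ = ψ and ψ² = ζ·bar(ζ⁻¹); the right-hand side is 2 on words A⋯AD⋯D and 0 on all
-- other nonempty ones.  Square roots are unique as 2 is invertible, and the square root is
-- ψ(w) = [xⁿ] (1 + x)(1 - x²)^(p - 1/2), p being the number of factors DA in w: sliding a factor DA
-- along w does not change ψ²(w), so ψ²(w) = [xⁿ] (1 + x)²(1 - x²)^(p - 1), which vanishes for p > 0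
-- because n > 2p.  The recurrence C(p,q+1) + C(p+1,q) = 4C(p,q) identifies these coefficients with
-- signed quotients C(p,q)/4^(p+q), and φ₊ is recovered from ζφ₊ = ψ.

open import Defs
open import Algebra.Apartness.Bundles using (HeytingField)
open import Data.List.Base using (List; reverse)
open import Data.Nat.Base as ℕ using (ℕ; _∸_; ⌊_/2⌋)
open import Data.Nat.Divisibility.Core using (_∣_)
open import Data.Product.Base using (_×_)
open import Relation.Nullary.Negation using (¬_)

open import Algebra.Bundles using (CommutativeRing)
open import Algebra.Morphism.Structures using (module RingMorphisms)
import Algebra.Properties.Ring as RingProperties
import Algebra.Properties.Semiring.Exp as Exponentiation
import Algebra.Properties.Semiring.Mult as Multiples
import Algebra.Solver.Ring.NaturalCoefficients.Default as NaturalSolver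
open import Data.Bool.Base using (Bool; true; false; not; if_then_else_)
import Data.Bool.Properties as Bool
open import Data.Empty using (⊥-elim)
open import Data.List.Base using
  ([]; _∷_; _∷ʳ_; _++_; [_]; length; map; concatMap; filter; foldr; take; drop; upTo; applyUpTo; applyDownFrom)
import Data.List.Membership.DecPropositional as DecMembership
open import Data.List.Membership.Propositional using (_∈_; _∉_)
open import Data.List.Membership.Propositional.Properties using (∈-map⁺; ∈-map⁻)
import Data.List.Properties as List
open import Data.List.Relation.Binary.Permutation.Propositional.Properties
  using (↭-reverse; ↭-length; filter-↭)
open import Data.List.Relation.Unary.All as All using (All; []; _∷_)
import Data.List.Relation.Unary.All.Properties as All
open import Data.List.Relation.Unary.Any using (here; there)
open import Data.Nat.Base using (zero; suc; z≤n; s≤s; _!)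
open import Data.Nat.Combinatorics using (k![n∸k]!∣n!)
open import Data.Nat.Divisibility.Core using (divides)
import Data.Nat.DivMod as ℕ
open import Data.Nat.ListAction using (sum)
import Data.Nat.Properties as ℕ
open import Data.Nat.Tactic.RingSolver using (solve-∀)
open import Data.Product.Base using (_,_; proj₁; proj₂; ∃-syntax)
open import Function.Base using (_∘_)
open import Function.Bundles using (_⇔_; mk⇔; Equivalence)
open import Relation.Binary.PropositionalEquality as ≡ using (_≡_; refl; cong; cong₂; subst)
import Relation.Binary.Reasoning.Setoid as SetoidReasoning
open import Relation.Nullary.Decidable using (Dec; does; yes; no; ¬?; dec-true; dec-false; does-⇔)
open import Relation.Unary using (Decidable; Pred)

open DecMembership ℕ._≟_ using (_∈?_)

-- A ribbon with n boxes can be cut in n + 1 places, and a cut between two boxes loses the letter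
-- standing there. Functions are therefore evaluated on words of length n with a dummy letter before
-- the first box: the lost letter becomes the dummy of the right piece, and every cut of the word is
-- allowed. The series for p = 0 is the square root of (1 + x)/(1 - x), the series of the square on
-- words without DA. A cut right before D or right before A destroys a factor DA; any other cut
-- leaves it in one piece. If each factor contributes 1 - x², it can be credited to either piece:
-- moving 1 - x² from one series of a product to the other produces exactly two boundary terms, and
-- these are the two destroying cuts. The field may have any characteristic other than 2, so the
-- convolution identity for central binomial coefficients, whose proof cancels the degree, is
-- established for natural numbers and then transported; in the field only 2 is inverted.

-- Integrality and recurrences of the numbers C(p, q)

module SuperCatalan where
  open import Data.Nat.Base using (_+_; _*_; _≤_; NonZero)

  numerator denominator : ℕ → ℕ → ℕ
  numerator   p q = (2 * p) ! * (2 * q) !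
  denominator p q = p ! * (p + q) ! * q !

  denominator≢0 : ∀ p q → NonZero (denominator p q)
  denominator≢0 p q = ℕ.m*n≢0 _ _ {{p ℕ.!* (p + q) !≢0}} {{q ℕ.!≢0}}

  !-2+ : ∀ n → (2 * suc n) ! ≡ (2 + 2 * n) * ((1 + 2 * n) * (2 * n) !)
  !-2+ n = cong _! (ℕ.*-suc 2 n)

  numerator-sucˡ : ∀ p q → numerator (suc p) q ≡ (2 + 2 * p) * (1 + 2 * p) * numerator p q
  numerator-sucˡ p q rewrite !-2+ p = lemma p ((2 * p) !) ((2 * q) !)
    where
    lemma : ∀ p x y → (2 + 2 * p) * ((1 + 2 * p) * x) * y ≡ (2 + 2 * p) * (1 + 2 * p) * (x * y)
    lemma = solve-∀

  numerator-sucʳ : ∀ p q → numerator p (suc q) ≡ (2 + 2 * q) * (1 + 2 * q) * numerator p q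
  numerator-sucʳ p q rewrite !-2+ q = lemma q ((2 * p) !) ((2 * q) !)
    where
    lemma : ∀ q x y → x * ((2 + 2 * q) * ((1 + 2 * q) * y)) ≡ (2 + 2 * q) * (1 + 2 * q) * (x * y)
    lemma = solve-∀

  denominator-sucˡ : ∀ p q → denominator (suc p) q ≡ (1 + p) * (1 + p + q) * denominator p q
  denominator-sucˡ p q = lemma p q (p !) ((p + q) !) (q !)
    where
    lemma : ∀ p q x y z → (x + p * x) * (y + (p + q) * y) * z ≡ (1 + p) * (1 + p + q) * (x * y * z)
    lemma = solve-∀

  denominator-sucʳ : ∀ p q → denominator p (suc q) ≡ (1 + p + q) * (1 + q) * denominator p q
  denominator-sucʳ p q rewrite ℕ.+-suc p q = lemma p q (p !) ((p + q) !) (q !)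
    where
    lemma : ∀ p q x y z → x * (y + (p + q) * y) * (z + q * z) ≡ (1 + p + q) * (1 + q) * (x * y * z)
    lemma = solve-∀

  Exact : ℕ → ℕ → Set
  Exact p q = C p q * denominator p q ≡ numerator p q

  ∣⇒exact : ∀ p q → denominator p q ∣ numerator p q → Exact p q
  ∣⇒exact p q = ℕ.m/n*n≡m {{denominator≢0 p q}}

  C-unique : ∀ p q {x} → x * denominator p q ≡ numerator p q → C p q ≡ x
  C-unique p q {x} eq = ℕ.*-cancelʳ-≡ _ _ _ {{denominator≢0 p q}}
    (≡.trans (∣⇒exact p q (divides x (≡.sym eq))) (≡.sym eq))

  module _ (p q : ℕ) (exact : Exact p q) (exact⁺ : Exact p (suc q)) where

    private
      a = C p q
      b = C p (suc q)

    sucʳ : b * (1 + p + q) ≡ (2 + 4 * q) * a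
    sucʳ = ℕ.*-cancelʳ-≡ _ _ (suc q * denominator p q)
      {{ℕ.m*n≢0 (suc q) _ {{_}} {{denominator≢0 p q}}}} (begin
      b * (1 + p + q) * (suc q * denominator p q)
        ≡⟨ lemma₁ b p q (denominator p q) ⟩
      b * ((1 + p + q) * (1 + q) * denominator p q)
        ≡⟨ cong (b *_) (denominator-sucʳ p q) ⟨
      b * denominator p (suc q)
        ≡⟨ exact⁺ ⟩
      numerator p (suc q)
        ≡⟨ numerator-sucʳ p q ⟩
      (2 + 2 * q) * (1 + 2 * q) * numerator p q
        ≡⟨ cong ((2 + 2 * q) * (1 + 2 * q) *_) exact ⟨
      (2 + 2 * q) * (1 + 2 * q) * (a * denominator p q)
        ≡⟨ lemma₂ a q (denominator p q) ⟩
      (2 + 4 * q) * a * (suc q * denominator p q) ∎)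
      where
      open ≡.≡-Reasoning
      lemma₁ : ∀ b p q d → b * (1 + p + q) * ((1 + q) * d) ≡ b * ((1 + p + q) * (1 + q) * d)
      lemma₁ = solve-∀
      lemma₂ : ∀ a q d → (2 + 2 * q) * (1 + 2 * q) * (a * d) ≡ (2 + 4 * q) * a * ((1 + q) * d)
      lemma₂ = solve-∀

    -- By `sucʳ` the ratio of `b` to `a` is (2 + 4q)/(1 + p + q). The bound makes the truncated
    -- subtraction in `x` a true difference.
    b≤4a : b ≤ 4 * a
    b≤4a = ℕ.*-cancelʳ-≤ _ _ (1 + p + q) (begin
      b * (1 + p + q)                    ≡⟨ sucʳ ⟩
      (2 + 4 * q) * a                    ≤⟨ ℕ.m≤m+n _ ((2 + 4 * p) * a) ⟩
      (2 + 4 * q) * a + (2 + 4 * p) * a  ≡⟨ lemma a p q ⟩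
      4 * a * (1 + p + q)                ∎)
      where
      open ℕ.≤-Reasoning
      lemma : ∀ a p q → (2 + 4 * q) * a + (2 + 4 * p) * a ≡ 4 * a * (1 + p + q)
      lemma = solve-∀

    x : ℕ
    x = 4 * a ∸ b

    b+x : b + x ≡ 4 * a
    b+x = ℕ.m+[n∸m]≡n b≤4a

    sucˡ : x * (1 + p + q) ≡ (2 + 4 * p) * a
    sucˡ = ℕ.+-cancelˡ-≡ (b * (1 + p + q)) _ _ (begin
      b * (1 + p + q) + x * (1 + p + q)  ≡⟨ ℕ.*-distribʳ-+ (1 + p + q) b x ⟨
      (b + x) * (1 + p + q)              ≡⟨ cong (_* (1 + p + q)) b+x ⟩
      4 * a * (1 + p + q)                ≡⟨ lemma a p q ⟩
      (2 + 4 * q) * a + (2 + 4 * p) * a  ≡⟨ cong (_+ (2 + 4 * p) * a) sucʳ ⟨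
      b * (1 + p + q) + (2 + 4 * p) * a  ∎)
      where
      open ≡.≡-Reasoning
      lemma : ∀ a p q → 4 * a * (1 + p + q) ≡ (2 + 4 * q) * a + (2 + 4 * p) * a
      lemma = solve-∀

    x-exact : x * denominator (suc p) q ≡ numerator (suc p) q
    x-exact = begin
      x * denominator (suc p) q
        ≡⟨ cong (x *_) (denominator-sucˡ p q) ⟩
      x * ((1 + p) * (1 + p + q) * denominator p q)
        ≡⟨ lemma₁ x p q (denominator p q) ⟩
      x * (1 + p + q) * ((1 + p) * denominator p q)
        ≡⟨ cong (_* ((1 + p) * denominator p q)) sucˡ ⟩
      (2 + 4 * p) * a * ((1 + p) * denominator p q)
        ≡⟨ lemma₂ a p (denominator p q) ⟩
      (2 + 2 * p) * (1 + 2 * p) * (a * denominator p q)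
        ≡⟨ cong ((2 + 2 * p) * (1 + 2 * p) *_) exact ⟩
      (2 + 2 * p) * (1 + 2 * p) * numerator p q
        ≡⟨ numerator-sucˡ p q ⟨
      numerator (suc p) q ∎
      where
      open ≡.≡-Reasoning
      lemma₁ : ∀ x p q d → x * ((1 + p) * (1 + p + q) * d) ≡ x * (1 + p + q) * ((1 + p) * d)
      lemma₁ = solve-∀
      lemma₂ : ∀ a p d → (2 + 4 * p) * a * ((1 + p) * d) ≡ (2 + 2 * p) * (1 + 2 * p) * (a * d)
      lemma₂ = solve-∀

  -- Integrality travels along the recurrence: C(0, q) is a central binomial coefficient, and C(p +
  -- 1, q) is the integer 4C(p, q) - C(p, q + 1). The induction on p uses the previous row at both q
  -- and q + 1.
  C-exact : ∀ p q → Exact p q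
  C-exact zero    q = ∣⇒exact 0 q (≡.subst₂ _∣_
    (cong (_* q !) (≡.sym (ℕ.*-identityˡ (q !)))) (≡.sym (ℕ.*-identityˡ ((2 * q) !)))
    (subst (λ k → q ! * k ! ∣ (2 * q) !) 2*q∸q≡q (k![n∸k]!∣n! (ℕ.m≤m+n q (q + 0)))))
    where
    2*q∸q≡q : 2 * q ∸ q ≡ q
    2*q∸q≡q = ≡.trans (ℕ.m+n∸m≡n q (q + 0)) (ℕ.+-identityʳ q)
  C-exact (suc p) q = ∣⇒exact (suc p) q
    (divides (4 * C p q ∸ C p (suc q)) (≡.sym (x-exact p q (C-exact p q) (C-exact p (suc q)))))

  C-Pascal : ∀ p q → C p (suc q) + C (suc p) q ≡ 4 * C p q
  C-Pascal p q = ≡.trans (cong (C p (suc q) +_) (C-unique (suc p) q (x-exact p q e e⁺)))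
                         (b+x p q e e⁺)
    where
    e  = C-exact p q
    e⁺ = C-exact p (suc q)

  -- (2q)! / (q! q!)
  central : ℕ → ℕ
  central = C 0

  central-suc : ∀ q → (1 + q) * central (suc q) ≡ (2 + 4 * q) * central q
  central-suc q = ≡.trans (ℕ.*-comm (1 + q) _) (sucʳ 0 q (C-exact 0 q) (C-exact 0 (suc q)))

  -- Σₖ central (i + k) · central (j ∸ k) over 0 ≤ k ≤ j
  partialConv : ℕ → ℕ → ℕ
  partialConv i zero    = central i * central 0
  partialConv i (suc j) = central i * central (suc j) + partialConv (suc i) j

  -- The factors 2 + 4j and 2 + 4i coming from `central-suc` add up to a number that depends on i +
  -- j only, so it can be pulled out of a convolution.
  central-step : ∀ i j →
    (1 + j) * (central i * central (suc j)) + (1 + i) * (central (suc i) * central j) ≡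
    4 * (1 + i + j) * (central i * central j)
  central-step i j = begin
    (1 + j) * (c i * c (suc j)) + (1 + i) * (c (suc i) * c j)
      ≡⟨ lemma₁ i j (c i) (c j) (c (suc i)) (c (suc j)) ⟩
    c i * ((1 + j) * c (suc j)) + ((1 + i) * c (suc i)) * c j
      ≡⟨ cong₂ (λ x y → c i * x + y * c j) (central-suc j) (central-suc i) ⟩
    c i * ((2 + 4 * j) * c j) + ((2 + 4 * i) * c i) * c j
      ≡⟨ lemma₂ i j (c i) (c j) ⟩
    4 * (1 + i + j) * (c i * c j) ∎
    where
    open ≡.≡-Reasoning
    c = central
    lemma₁ : ∀ i j x y x⁺ y⁺ → (1 + j) * (x * y⁺) + (1 + i) * (x⁺ * y) ≡
                               x * ((1 + j) * y⁺) + ((1 + i) * x⁺) * y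
    lemma₁ = solve-∀
    lemma₂ : ∀ i j x y → x * ((2 + 4 * j) * y) + ((2 + 4 * i) * x) * y ≡ 4 * (1 + i + j) * (x * y)
    lemma₂ = solve-∀

  -- A Zeilberger certificate for Σₖ central k · central (m ∸ k) = 4ᵐ, which is the case i = 0.
  partialConv-suc : ∀ i j → (1 + i + j) * partialConv i (suc j) ≡
                    4 * (1 + i + j) * partialConv i j + i * (central i * central (suc j))
  partialConv-suc i zero = begin
    (1 + i + 0) * (c i * c 1 + c (suc i) * c 0)
      ≡⟨ lemma₁ i (c i * c 1) (c (suc i) * c 0) ⟩
    1 * (c i * c 1) + (1 + i) * (c (suc i) * c 0) + i * (c i * c 1)
      ≡⟨ cong (_+ i * (c i * c 1)) (central-step i 0) ⟩
    4 * (1 + i + 0) * (c i * c 0) + i * (c i * c 1) ∎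
    where
    open ≡.≡-Reasoning
    c = central
    lemma₁ : ∀ i x y → (1 + i + 0) * (x + y) ≡ 1 * x + (1 + i) * y + i * x
    lemma₁ = solve-∀
  partialConv-suc i (suc j) = begin
    (1 + i + suc j) * (c i * c (2 + j) + w⁺)
      ≡⟨ lemma₁ i j (c i * c (2 + j)) w⁺ ⟩
    (1 + suc i + j) * w⁺ + (1 + i + suc j) * (c i * c (2 + j))
      ≡⟨ cong (_+ (1 + i + suc j) * (c i * c (2 + j))) (partialConv-suc (suc i) j) ⟩
    4 * (1 + suc i + j) * w + suc i * (c (suc i) * c (suc j)) + (1 + i + suc j) * (c i * c (2 + j))
      ≡⟨ lemma₂ i j w (c i * c (2 + j)) (c (suc i) * c (suc j)) ⟩
    4 * (1 + i + suc j) * w + i * (c i * c (2 + j)) +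
      ((2 + j) * (c i * c (2 + j)) + (1 + i) * (c (suc i) * c (suc j)))
      ≡⟨ cong (4 * (1 + i + suc j) * w + i * (c i * c (2 + j)) +_) (central-step i (suc j)) ⟩
    4 * (1 + i + suc j) * w + i * (c i * c (2 + j)) + 4 * (1 + i + suc j) * (c i * c (suc j))
      ≡⟨ lemma₃ (4 * (1 + i + suc j)) w (i * (c i * c (2 + j))) (c i * c (suc j)) ⟩
    4 * (1 + i + suc j) * (c i * c (suc j) + w) + i * (c i * c (2 + j)) ∎
    where
    open ≡.≡-Reasoning
    c  = central
    w  = partialConv (suc i) j
    w⁺ = partialConv (suc i) (suc j)
    lemma₁ : ∀ i j x y → (1 + i + (1 + j)) * (x + y) ≡ (1 + (1 + i) + j) * y + (1 + i + (1 + j)) * x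
    lemma₁ = solve-∀
    lemma₂ : ∀ i j w x y →
      4 * (1 + (1 + i) + j) * w + (1 + i) * y + (1 + i + (1 + j)) * x ≡
      4 * (1 + i + (1 + j)) * w + i * x + ((2 + j) * x + (1 + i) * y)
    lemma₂ = solve-∀
    lemma₃ : ∀ k w x y → k * w + x + k * y ≡ k * (y + w) + x
    lemma₃ = solve-∀

  -- The boundary term of `partialConv-suc` carries the factor i and disappears here. In terms of
  -- series, the square of (1 - 4x)^(-1/2) is 1/(1 - 4x).
  partialConv-0 : ∀ j → partialConv 0 j ≡ 4 ℕ.^ j
  partialConv-0 zero    = refl
  partialConv-0 (suc j) = ℕ.*-cancelˡ-≡ _ _ (suc j) (≡.trans (partialConv-suc 0 j) (≡.trans
    (lemma j (partialConv 0 j)) (cong (λ k → suc j * (4 * k)) (partialConv-0 j))))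
    where
    lemma : ∀ j w → 4 * (1 + j) * w + 0 ≡ (1 + j) * (4 * w)
    lemma = solve-∀

-- Factors DA and parity

-- DA factors of b ∷ w, where true stands for a descent and false for an ascent
countDA : Bool → List Bool → ℕ
countDA b     []          = 0
countDA b     (true  ∷ w) = countDA true w
countDA true  (false ∷ w) = suc (countDA false w)
countDA false (false ∷ w) = countDA false w

-- Factors DA cannot overlap, so each uses two letters of its own; a preceding D adds one letter to
-- the supply.
2*countDA-false≤ : ∀ w → 2 ℕ.* countDA false w ℕ.≤ length w
2*countDA-true≤  : ∀ w → 2 ℕ.* countDA true w ℕ.≤ suc (length w)
2*countDA-false≤ []          = z≤n
2*countDA-false≤ (true  ∷ w) = 2*countDA-true≤ w
2*countDA-false≤ (false ∷ w) = ℕ.m≤n⇒m≤1+n (2*countDA-false≤ w)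
2*countDA-true≤ []          = z≤n
2*countDA-true≤ (true  ∷ w) = ℕ.m≤n⇒m≤1+n (2*countDA-true≤ w)
2*countDA-true≤ (false ∷ w) = subst (ℕ._≤ suc (suc (length w))) (≡.sym (ℕ.*-suc 2 (countDA false w)))
                           (s≤s (s≤s (2*countDA-false≤ w)))

even? : ℕ → Bool
even? 0             = true
even? 1             = false
even? (suc (suc n)) = even? n

even?-suc : ∀ n → even? (suc n) ≡ not (even? n)
even?-suc 0             = refl
even?-suc 1             = refl
even?-suc (suc (suc n)) = even?-suc n

⌊1+n/2⌋≡⌊n/2⌋ : ∀ n → even? n ≡ true → ⌊ suc n /2⌋ ≡ ⌊ n /2⌋
⌊1+n/2⌋≡⌊n/2⌋ 0             _  = refl
⌊1+n/2⌋≡⌊n/2⌋ (suc (suc n)) ev = cong suc (⌊1+n/2⌋≡⌊n/2⌋ n ev)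

≤⌊/2⌋ : ∀ {p n} → 2 ℕ.* p ℕ.≤ n → p ℕ.≤ ⌊ n /2⌋
≤⌊/2⌋ {p} {n} 2p≤n = subst (ℕ._≤ ⌊ n /2⌋)
  (≡.sym (≡.trans (ℕ.n≡⌊n+n/2⌋ p) (cong (λ k → ⌊ p ℕ.+ k /2⌋) (≡.sym (ℕ.+-identityʳ p)))))
  (ℕ.⌊n/2⌋-mono 2p≤n)

2*⌊n/2⌋≡n : ∀ n → even? n ≡ true → 2 ℕ.* ⌊ n /2⌋ ≡ n
2*⌊n/2⌋≡n zero          _    = refl
2*⌊n/2⌋≡n (suc (suc n)) even =
  ≡.trans (ℕ.*-suc 2 ⌊ n /2⌋) (cong (suc ∘ suc) (2*⌊n/2⌋≡n n even))

2∣⇒even? : ∀ n → 2 ∣ n → even? n ≡ true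
2∣⇒even? n (divides q refl) = go q
  where
  go : ∀ q → even? (q ℕ.* 2) ≡ true
  go zero    = refl
  go (suc q) = go q

2∤⇒even? : ∀ n → ¬ (2 ∣ n) → even? n ≡ false
2∤⇒even? n 2∤n with even? n in ev
... | true  = ⊥-elim (2∤n (divides ⌊ n /2⌋ (≡.trans (≡.sym (2*⌊n/2⌋≡n n ev)) (ℕ.*-comm 2 ⌊ n /2⌋))))
... | false = refl

-- Compositions as descent words, and the statistics on them

-- A composition of n > 0 is encoded by the word whose d-th letter tells whether d is a descent.
ribbon : List Bool → List ℕ
leading : List Bool → ℕ
remaining : List Bool → List ℕ
ribbon w = suc (leading w) ∷ remaining w
leading []          = 0
leading (true  ∷ w) = 0
leading (false ∷ w) = suc (leading w)
remaining []          = []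
remaining (true  ∷ w) = ribbon w
remaining (false ∷ w) = remaining w

ribbon-⊨ : ∀ w → ribbon w ⊨ suc (length w)
ribbon-⊨ []          = s≤s z≤n ∷ [] , refl
ribbon-⊨ (true  ∷ w) = ⊨-1∷ (ribbon-⊨ w)
ribbon-⊨ (false ∷ w) = ⊨-bump (ribbon-⊨ w)

sum-ribbon : ∀ w → sum (ribbon w) ≡ suc (length w)
sum-ribbon w = proj₂ (ribbon-⊨ w)

-- The first argument is the first part minus one, as in `leading`. Since `ℕ.pred` identifies 0 with
-- 1, this inverts `ribbon` on positive parts only.
word : ℕ → List ℕ → List Bool
word zero    []      = []
word zero    (b ∷ β) = true ∷ word (ℕ.pred b) β
word (suc a) β       = false ∷ word a β

ribbon-word : ∀ a {β} → All (0 ℕ.<_) β → ribbon (word a β) ≡ suc a ∷ β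
ribbon-word zero    []                = refl
ribbon-word zero    {suc b ∷ β} (_ ∷ pos) = cong (1 ∷_) (ribbon-word b pos)
ribbon-word (suc a) pos               = cong bump (ribbon-word a pos)

word-ribbon : ∀ w → word (leading w) (remaining w) ≡ w
word-ribbon []          = refl
word-ribbon (true  ∷ w) = cong (true ∷_) (word-ribbon w)
word-ribbon (false ∷ w) = cong (false ∷_) (word-ribbon w)

ribbon-injective : ∀ v w → ribbon v ≡ ribbon w → v ≡ w
ribbon-injective v w eq = ≡.trans (≡.sym (word-ribbon v))
  (≡.trans (cong₂ word (List.∷-injectiveˡ (cong (map ℕ.pred) eq)) (List.∷-injectiveʳ eq)) (word-ribbon w))

ribbon-surjective : ∀ {α m} → α ⊨ suc m → ∃[ w ] ribbon w ≡ α × length w ≡ m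
ribbon-surjective {suc a ∷ α} (_ ∷ pos , tot) = w , eq ,
  ℕ.suc-injective (≡.trans (≡.sym (sum-ribbon w)) (≡.trans (cong sum eq) tot))
  where
  w  = word a α
  eq = ribbon-word a pos

-- The order matches that of `compositions`, so that sums over compositions become sums over words
-- by an equality of lists.
words : ℕ → List (List Bool)
words zero    = [ [] ]
words (suc n) = concatMap (λ v → (true ∷ v) ∷ (false ∷ v) ∷ []) (words n)

compositions-ribbon : ∀ n → compositions (suc n) ≡ map ribbon (words n)
compositions-ribbon zero    = refl
compositions-ribbon (suc n) rewrite compositions-ribbon n = go (words n)
  where
  go : ∀ vs → concatMap (λ β → (1 ∷ β) ∷ bump β ∷ []) (map ribbon vs) ≡
              map ribbon (concatMap (λ v → (true ∷ v) ∷ (false ∷ v) ∷ []) vs)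
  go []       = refl
  go (v ∷ vs) = cong (λ γs → (1 ∷ ribbon v) ∷ bump (ribbon v) ∷ γs) (go vs)

-- A part exceeds 1 exactly when an ascent follows the descent that opens it. The first part has no
-- such descent: `true` in front supplies one, and `false` leaves this part out.
count>1-ribbon    : ∀ w → count>1 (ribbon w) ≡ countDA true w
count>1-remaining : ∀ w → count>1 (remaining w) ≡ countDA false w
count>1-ribbon []          = refl
count>1-ribbon (true  ∷ w) = count>1-ribbon w
count>1-ribbon (false ∷ w) = cong suc (count>1-remaining w)
count>1-remaining []          = refl
count>1-remaining (true  ∷ w) = count>1-ribbon w
count>1-remaining (false ∷ w) = count>1-remaining w

count>1-reverse : ∀ α → count>1 (reverse α) ≡ count>1 α
count>1-reverse α = ↭-length (filter-↭ (1 ℕ.<?_) (↭-reverse α))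

take-length-∷ʳ : ∀ {A : Set} (xs : List A) x → take (length (xs ∷ʳ x) ∸ 1) (xs ∷ʳ x) ≡ xs
take-length-∷ʳ []           x = refl
take-length-∷ʳ (_ ∷ [])     x = refl
take-length-∷ʳ (y ∷ z ∷ xs) x = cong (y ∷_) (take-length-∷ʳ (z ∷ xs) x)

-- The last part of the reversal, which `p₋` drops, is the first part of the ribbon; the count over
-- the others ignores their order.
p₋-reverse : ∀ w → p₋ (reverse (ribbon w)) ≡ countDA false w
p₋-reverse w
  rewrite List.unfold-reverse (suc (leading w)) (remaining w)
        | take-length-∷ʳ (reverse (remaining w)) (suc (leading w))
        | count>1-reverse (remaining w) = count>1-remaining w

p₊-bump : ∀ α → p₊ (bump α) ≡ p₊ α
p₊-bump []          = refl
p₊-bump (a ∷ [])    = refl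
p₊-bump (a ∷ b ∷ α) = refl

-- Appending an ascent accounts for the summand 1 of p₊: the last of several parts then exceeds 1.
p₊-ribbon : ∀ w → p₊ (ribbon w) ≡ countDA false (w ∷ʳ false)
p₊-1∷     : ∀ w → p₊ (1 ∷ ribbon w) ≡ countDA true (w ∷ʳ false)
p₊-ribbon []          = refl
p₊-ribbon (true  ∷ w) = p₊-1∷ w
p₊-ribbon (false ∷ w) = ≡.trans (p₊-bump (ribbon w)) (p₊-ribbon w)
p₊-1∷ []          = refl
p₊-1∷ (true  ∷ w) = p₊-1∷ w
p₊-1∷ (false ∷ w) = ≡.trans (lemma (leading w) (remaining w)) (cong suc (p₊-ribbon w))
  where
  lemma : ∀ a α → p₊ (1 ∷ suc (suc a) ∷ α) ≡ suc (p₊ (suc a ∷ α))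
  lemma a []      = refl
  lemma a (b ∷ α) = refl

-- Conjugation as reversal and complementation of the word

isDA : Bool → Bool → ℕ
isDA true  false = 1
isDA true  true  = 0
isDA false _     = 0

countDA-∷ʳ : ∀ b w y x → countDA b (w ++ y ∷ x ∷ []) ≡ isDA y x ℕ.+ countDA b (w ∷ʳ y)
countDA-∷ʳ true  []      true  true  = refl
countDA-∷ʳ true  []      true  false = refl
countDA-∷ʳ true  []      false true  = refl
countDA-∷ʳ true  []      false false = refl
countDA-∷ʳ false []      true  true  = refl
countDA-∷ʳ false []      true  false = refl
countDA-∷ʳ false []      false true  = refl
countDA-∷ʳ false []      false false = refl
countDA-∷ʳ true  (true  ∷ w) y x = countDA-∷ʳ true w y x
countDA-∷ʳ false (true  ∷ w) y x = countDA-∷ʳ true w y x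
countDA-∷ʳ true  (false ∷ w) y x = ≡.trans (cong suc (countDA-∷ʳ false w y x)) (≡.sym (ℕ.+-suc _ _))
countDA-∷ʳ false (false ∷ w) y x = countDA-∷ʳ false w y x

countDA-∷∷ : ∀ x y w → countDA false (x ∷ y ∷ w) ≡ isDA x y ℕ.+ countDA false (y ∷ w)
countDA-∷∷ true  true  w = refl
countDA-∷∷ true  false w = refl
countDA-∷∷ false y     w = refl

reverseNot : List Bool → List Bool
reverseNot w = map not (reverse w)

reverseNot-∷ : ∀ x w → reverseNot (x ∷ w) ≡ reverseNot w ∷ʳ not x
reverseNot-∷ x w rewrite List.unfold-reverse x w = List.map-++ not (reverse w) [ x ]

-- Reversal turns DA into AD, and complementation turns AD back into DA.
countDA-reverseNot : ∀ w → countDA false (reverseNot w) ≡ countDA false w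
countDA-reverseNot []          = refl
countDA-reverseNot (true  ∷ []) = refl
countDA-reverseNot (false ∷ []) = refl
countDA-reverseNot (x ∷ y ∷ w) = begin
  countDA false (reverseNot (x ∷ y ∷ w))
    ≡⟨ cong (countDA false) (≡.trans (reverseNot-∷ x (y ∷ w)) (≡.trans (cong (_∷ʳ not x) (reverseNot-∷ y w))
         (List.++-assoc (reverseNot w) [ not y ] [ not x ]))) ⟩
  countDA false (reverseNot w ++ not y ∷ not x ∷ [])
    ≡⟨ countDA-∷ʳ false (reverseNot w) (not y) (not x) ⟩
  isDA (not y) (not x) ℕ.+ countDA false (reverseNot w ∷ʳ not y)
    ≡⟨ cong₂ ℕ._+_ (flip x y) (cong (countDA false) (≡.sym (reverseNot-∷ y w))) ⟩
  isDA x y ℕ.+ countDA false (reverseNot (y ∷ w))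
    ≡⟨ cong (isDA x y ℕ.+_) (countDA-reverseNot (y ∷ w)) ⟩
  isDA x y ℕ.+ countDA false (y ∷ w)
    ≡⟨ countDA-∷∷ x y w ⟨
  countDA false (x ∷ y ∷ w) ∎
  where
  open ≡.≡-Reasoning
  flip : ∀ x y → isDA (not y) (not x) ≡ isDA x y
  flip true  true  = refl
  flip true  false = refl
  flip false true  = refl
  flip false false = refl

descents : List Bool → List ℕ
descents w = D (ribbon w)

descents-false : ∀ w → descents (false ∷ w) ≡ map suc (descents w)
descents-false w = D-bump (ribbon w)

0∉map-suc : ∀ xs → 0 ∉ map suc xs
0∉map-suc xs 0∈ with ∈-map⁻ suc {xs = xs} 0∈
... | _ , _ , ()

0∉descents : ∀ w → 0 ∉ descents w
0∉descents (true  ∷ w) (there 0∈) = 0∉map-suc (descents w) 0∈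
0∉descents (false ∷ w) 0∈ = 0∉map-suc (descents w) (subst (0 ∈_) (descents-false w) 0∈)

suc∈map-suc : ∀ {x xs} → suc x ∈ map suc xs ⇔ x ∈ xs
suc∈map-suc {x} {xs} = mk⇔ to (∈-map⁺ suc)
  where
  to : suc x ∈ map suc xs → x ∈ xs
  to sx∈ with ∈-map⁻ suc sx∈
  ... | _ , x∈ , refl = x∈

-- A new first letter shifts the old descents by one and decides by itself whether 1 is a descent,
-- hence the exclusion of `x ≡ 0`.
suc∈descents-∷ : ∀ b {x} w → ¬ (x ≡ 0) → suc x ∈ descents (b ∷ w) ⇔ x ∈ descents w
suc∈descents-∷ true w x≢0 = mk⇔
  (λ { (here refl) → ⊥-elim (x≢0 refl) ; (there sx∈) → Equivalence.to suc∈map-suc sx∈ })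
  (there ∘ Equivalence.from suc∈map-suc)
suc∈descents-∷ false {x} w _ = subst (λ X → suc x ∈ X ⇔ x ∈ descents w)
  (≡.sym (descents-false w)) suc∈map-suc

1∉descents-false : ∀ w → 1 ∉ descents (false ∷ w)
1∉descents-false w 1∈ = 0∉descents w
  (Equivalence.to suc∈map-suc (subst (1 ∈_) (descents-false w) 1∈))

isDescent : List Bool → ℕ → Bool
isDescent w i = does (suc i ∈? descents w)

isDescent-0 : ∀ x w → isDescent (x ∷ w) 0 ≡ x
isDescent-0 true  w = dec-true (1 ∈? descents (true ∷ w)) (here refl)
isDescent-0 false w = dec-false (1 ∈? descents (false ∷ w)) (1∉descents-false w)

isDescent-suc : ∀ x w i → isDescent (x ∷ w) (suc i) ≡ isDescent w i
isDescent-suc x w i = does-⇔ (suc∈descents-∷ x w λ ()) (_ ∈? descents (x ∷ w)) (suc i ∈? descents w)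

applyUpTo-cong : ∀ {A : Set} {f g : ℕ → A} n → (∀ {i} → i ℕ.< n → f i ≡ g i) →
                 applyUpTo f n ≡ applyUpTo g n
applyUpTo-cong zero    f≡g = refl
applyUpTo-cong (suc n) f≡g = cong₂ _∷_ (f≡g (s≤s z≤n)) (applyUpTo-cong n (f≡g ∘ s≤s))

word≡isDescent : ∀ w → applyUpTo (isDescent w) (length w) ≡ w
word≡isDescent []      = refl
word≡isDescent (x ∷ w) = cong₂ _∷_ (isDescent-0 x w)
  (≡.trans (applyUpTo-cong (length w) (λ {i} _ → isDescent-suc x w i)) (word≡isDescent w))

applyDownFrom-applyUpTo : ∀ {A : Set} (f : ℕ → A) n →
  applyDownFrom f n ≡ applyUpTo (λ i → f (n ∸ suc i)) n
applyDownFrom-applyUpTo f zero    = refl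
applyDownFrom-applyUpTo f (suc n) = cong (f n ∷_) (applyDownFrom-applyUpTo f n)

fromDescents-ribbon : ∀ {p} {P : Pred ℕ p} (P? : Decidable P) n →
  fromDescents P? (suc n) ≡ ribbon (applyUpTo (λ i → does (P? (suc i))) n)
fromDescents-ribbon P? zero = refl
fromDescents-ribbon P? (suc n) with does (P? 1)
... | true  = cong (1 ∷_) (fromDescents-ribbon (P? ∘ suc) n)
... | false = cong bump (fromDescents-ribbon (P? ∘ suc) n)

conjugate-ribbon : ∀ w → conjugate (suc (length w)) (ribbon w) ≡ ribbon (reverseNot w)
conjugate-ribbon w = ≡.trans
  (fromDescents-ribbon (λ d → ¬? (suc n ∸ d ∈? descents w)) n) (cong ribbon (begin
  applyUpTo (λ i → not (does (n ∸ i ∈? descents w))) n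
    -- For i < n the number n ∸ i is the successor of n ∸ suc i, the position at which `isDescent`
    -- reads it: letters are numbered from 0 and descents from 1.
    ≡⟨ applyUpTo-cong n (λ {i} i<n → cong (λ d → not (does (d ∈? descents w))) (ℕ.+-∸-assoc 1 i<n)) ⟩
  applyUpTo (λ i → not (isDescent w (n ∸ suc i))) n
    ≡⟨ List.map-applyUpTo (λ i → isDescent w (n ∸ suc i)) not n ⟨
  map not (applyUpTo (λ i → isDescent w (n ∸ suc i)) n)
    ≡⟨ cong (map not) (applyDownFrom-applyUpTo (isDescent w) n) ⟨
  map not (applyDownFrom (isDescent w) n)
    ≡⟨ cong (map not) (List.reverse-applyUpTo (isDescent w) n) ⟨
  reverseNot (applyUpTo (isDescent w) n)
    ≡⟨ cong reverseNot (word≡isDescent w) ⟩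
  reverseNot w ∎))
  where
  open ≡.≡-Reasoning
  n = length w

-- The ascent that `p₊-ribbon` appends is the complement of a D, so it comes from a D in front of
-- `w` before reversal.
p₊-conjugate : ∀ w → p₊ (conjugate (suc (length w)) (ribbon w)) ≡ countDA true w
p₊-conjugate w = begin
  p₊ (conjugate (suc (length w)) (ribbon w))  ≡⟨ cong p₊ (conjugate-ribbon w) ⟩
  p₊ (ribbon (reverseNot w))                  ≡⟨ p₊-ribbon (reverseNot w) ⟩
  countDA false (reverseNot w ∷ʳ false)            ≡⟨ cong (countDA false) (reverseNot-∷ true w) ⟨
  countDA false (reverseNot (true ∷ w))            ≡⟨ countDA-reverseNot (true ∷ w) ⟩
  countDA true w                                   ∎
  where open ≡.≡-Reasoning

-- Refinement, letter by letter

refines : List Bool → List Bool → Bool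
refines v w = does (ribbon v refines? ribbon w)

All-descents-∷ : ∀ x v w →
  All (_∈ descents (x ∷ v)) (map suc (descents w)) ⇔ All (_∈ descents v) (descents w)
All-descents-∷ x v w = mk⇔
  (λ all → All.tabulate λ {d} d∈ → Equivalence.to (suc∈descents-∷ x v (≢0 d∈))
             (All.lookup all (∈-map⁺ suc d∈)))
  (λ all → All.map⁺ (All.tabulate λ {d} d∈ → Equivalence.from (suc∈descents-∷ x v (≢0 d∈))
             (All.lookup all d∈)))
  where
  ≢0 : ∀ {d} → d ∈ descents w → ¬ (d ≡ 0)
  ≢0 d∈ refl = 0∉descents w d∈

refines-false : ∀ x v w → refines (x ∷ v) (false ∷ w) ≡ refines v w
refines-false x v w = does-⇔
  (subst (λ X → All (_∈ descents (x ∷ v)) X ⇔ ribbon v Refines ribbon w)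
     (≡.sym (descents-false w)) (All-descents-∷ x v w))
  (ribbon (x ∷ v) refines? ribbon (false ∷ w)) (ribbon v refines? ribbon w)

refines-true : ∀ v w → refines (true ∷ v) (true ∷ w) ≡ refines v w
refines-true v w = does-⇔
  (mk⇔ (λ { (_ ∷ all) → Equivalence.to (All-descents-∷ true v w) all })
       (λ all → here refl ∷ Equivalence.from (All-descents-∷ true v w) all))
  (ribbon (true ∷ v) refines? ribbon (true ∷ w)) (ribbon v refines? ribbon w)

refines-false-true : ∀ v w → refines (false ∷ v) (true ∷ w) ≡ false
refines-false-true v w = dec-false (ribbon (false ∷ v) refines? ribbon (true ∷ w))
  (λ { (1∈ ∷ _) → 1∉descents-false v 1∈ })

-- Signs and powers of one half in the field

module Parts {c ℓ₁ ℓ₂} (K : HeytingField c ℓ₁ ℓ₂) (2#0 : CharNot2 K) where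
  open QuasiSymmetric K 2#0
  open CommutativeRing 𝕜 using () renaming (refl to ≈-refl; sym to ≈-sym; trans to ≈-trans)
  open RingProperties ring using (-1*x≈-x; -‿involutive; +-cancelʳ)
  open Exponentiation semiring using (^-homo-*)
  open Multiples semiring using (×-homo-+; ×1-homo-*)
  open NaturalSolver commutativeSemiring using (solve; _:=_; _:+_; _:*_)
  open SetoidReasoning setoid
  open SuperCatalan using (central; partialConv; partialConv-0; C-Pascal)

  x-y+y≈x : ∀ x y → x - y + y ≈ x
  x-y+y≈x x y = ≈-trans (+-assoc x (- y) y) (≈-trans (+-congˡ (-‿inverseˡ y)) (+-identityʳ x))

  -1+1≈0 : - 1# + 1# ≈ 0#
  -1+1≈0 = -‿inverseˡ 1#

  -1*-1≈1 : - 1# * - 1# ≈ 1#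
  -1*-1≈1 = ≈-trans (-1*x≈-x (- 1#)) (-‿involutive 1#)

  [-1]^-square : ∀ n → [-1]^ n * [-1]^ n ≈ 1#
  [-1]^-square zero    = *-identityˡ 1#
  [-1]^-square (suc n) = begin
    (- 1# * s) * (- 1# * s)   ≈⟨ solve 2 (λ t s → (t :* s) :* (t :* s) := (t :* t) :* (s :* s))
                                   ≈-refl (- 1#) s ⟩
    (- 1# * - 1#) * (s * s)   ≈⟨ *-cong -1*-1≈1 ([-1]^-square n) ⟩
    1# * 1#                   ≈⟨ *-identityˡ 1# ⟩
    1#                        ∎
    where s = [-1]^ n

  x+x≈y+y⇒x≈y : ∀ {x y} → x + x ≈ y + y → x ≈ y
  x+x≈y+y⇒x≈y {x} {y} eq = begin
    x             ≈⟨ half x ⟩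
    (x + x) * ½   ≈⟨ *-congʳ eq ⟩
    (y + y) * ½   ≈⟨ half y ⟨
    y             ∎
    where
    half : ∀ x → x ≈ (x + x) * ½
    half x = begin
      x                        ≈⟨ *-identityʳ x ⟨
      x * 1#                   ≈⟨ *-congˡ 2*½≈1 ⟨
      x * ((1# + 1#) * ½)      ≈⟨ *-assoc x _ _ ⟨
      x * (1# + 1#) * ½        ≈⟨ *-congʳ (≈-trans (distribˡ x 1# 1#)
                                    (+-cong (*-identityʳ x) (*-identityʳ x))) ⟩
      (x + x) * ½              ∎

  ι-+ : ∀ m n → ι (m ℕ.+ n) ≈ ι m + ι n
  ι-+ m n = ×-homo-+ 1# m n

  4*½*½≈1 : ι 4 * (½ * ½) ≈ 1#
  4*½*½≈1 = begin
    (1# + (1# + (1# + (1# + 0#)))) * (½ * ½)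
      ≈⟨ *-congʳ (+-congˡ (+-congˡ (+-congˡ (+-identityʳ 1#)))) ⟩
    (1# + (1# + (1# + 1#))) * (½ * ½)
      ≈⟨ solve 2 (λ o h → (o :+ (o :+ (o :+ o))) :* (h :* h) := (o :+ o) :* h :* (h :+ h)) ≈-refl 1# ½ ⟩
    (1# + 1#) * ½ * (½ + ½)
      ≈⟨ *-cong 2*½≈1 (≈-trans (+-cong (≈-sym (*-identityˡ ½)) (≈-sym (*-identityˡ ½)))
           (≈-trans (≈-sym (distribʳ ½ 1# 1#)) 2*½≈1)) ⟩
    1# * 1#
      ≈⟨ *-identityˡ 1# ⟩
    1# ∎

  ½^-2+ : ∀ k → ½ ^ (2 ℕ.* suc k) ≈ ½ * ½ * ½ ^ (2 ℕ.* k)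
  ½^-2+ k = ≈-trans (reflexive (cong (½ ^_) (ℕ.*-suc 2 k))) (≈-sym (*-assoc ½ ½ _))

  ι-4*-/2^ : ∀ m k → ι (4 ℕ.* m) /2^ (2 ℕ.* suc k) ≈ ι m /2^ (2 ℕ.* k)
  ι-4*-/2^ m k = begin
    ι (4 ℕ.* m) * ½ ^ (2 ℕ.* suc k)   ≈⟨ *-cong (×1-homo-* 4 m) (½^-2+ k) ⟩
    ι 4 * ι m * (½ * ½ * x)           ≈⟨ solve 4 (λ f m h x → f :* m :* (h :* x) := (f :* h) :* (m :* x))
                                           ≈-refl (ι 4) (ι m) (½ * ½) x ⟩
    ι 4 * (½ * ½) * (ι m * x)         ≈⟨ *-congʳ 4*½*½≈1 ⟩
    1# * (ι m * x)                    ≈⟨ *-identityˡ _ ⟩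
    ι m * x                           ∎
    where x = ½ ^ (2 ℕ.* k)

  -- The convolution algebra of functions on words

  conv : (f g : List Bool → Carrier) → List Bool → Carrier
  conv f g []      = f [] * g []
  conv f g (x ∷ w) = f [] * g (x ∷ w) + conv (f ∘ (x ∷_)) g w

  infix 4 _≐_
  _≐_ : (f g : List Bool → Carrier) → Set ℓ₁
  f ≐ g = ∀ w → f w ≈ g w

  conv-cong : ∀ {f f′ g g′} → f ≐ f′ → g ≐ g′ → conv f g ≐ conv f′ g′
  conv-cong f≐ g≐ []      = *-cong (f≐ []) (g≐ [])
  conv-cong f≐ g≐ (x ∷ w) = +-cong (*-cong (f≐ []) (g≐ (x ∷ w))) (conv-cong (f≐ ∘ (x ∷_)) g≐ w)

  conv-congˡ : ∀ {f f′ g} → f ≐ f′ → conv f g ≐ conv f′ g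
  conv-congˡ f≐ = conv-cong f≐ (λ _ → ≈-refl)

  conv-congʳ : ∀ {f g g′} → g ≐ g′ → conv f g ≐ conv f g′
  conv-congʳ {f} = conv-cong {f} (λ _ → ≈-refl)

  conv-+ : ∀ f f′ g w → conv (λ u → f u + f′ u) g w ≈ conv f g w + conv f′ g w
  conv-+ f f′ g []      = distribʳ _ _ _
  conv-+ f f′ g (x ∷ w) = ≈-trans (+-congˡ (conv-+ _ _ g w))
    (solve 5 (λ a b c d e → (a :+ b) :* c :+ (d :+ e) := (a :* c :+ d) :+ (b :* c :+ e)) ≈-refl
       (f []) (f′ []) (g (x ∷ w)) (conv (f ∘ (x ∷_)) g w) (conv (f′ ∘ (x ∷_)) g w))

  conv-* : ∀ k f g w → conv (λ u → k * f u) g w ≈ k * conv f g w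
  conv-* k f g []      = *-assoc _ _ _
  conv-* k f g (x ∷ w) = ≈-trans (+-cong (*-assoc _ _ _) (conv-* k _ g w)) (≈-sym (distribˡ _ _ _))

  conv-zero : ∀ g w → conv (λ _ → 0#) g w ≈ 0#
  conv-zero g []      = zeroˡ _
  conv-zero g (x ∷ w) = ≈-trans (+-cong (zeroˡ _) (conv-zero g w)) (+-identityˡ 0#)

  conv-assoc : ∀ f g h → conv (conv f g) h ≐ conv f (conv g h)
  conv-assoc f g h []      = *-assoc _ _ _
  conv-assoc f g h (x ∷ w) = begin
    f [] * g [] * h (x ∷ w) + conv (λ u → f [] * g (x ∷ u) + conv f′ g u) h w
      ≈⟨ +-congˡ (conv-+ _ _ h w) ⟩
    f [] * g [] * h (x ∷ w) + (conv (λ u → f [] * g (x ∷ u)) h w + conv (conv f′ g) h w)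
      ≈⟨ +-congˡ (+-cong (conv-* (f []) _ h w) (conv-assoc f′ g h w)) ⟩
    f [] * g [] * h (x ∷ w) + (f [] * conv (g ∘ (x ∷_)) h w + conv f′ (conv g h) w)
      ≈⟨ solve 5 (λ a b c d e → a :* b :* c :+ (a :* d :+ e) := a :* (b :* c :+ d) :+ e) ≈-refl
           (f []) (g []) (h (x ∷ w)) (conv (g ∘ (x ∷_)) h w) (conv f′ (conv g h) w) ⟩
    f [] * (g [] * h (x ∷ w) + conv (g ∘ (x ∷_)) h w) + conv f′ (conv g h) w ∎
    where f′ = f ∘ (x ∷_)

  δ : List Bool → Carrier
  δ []      = 1#
  δ (_ ∷ _) = 0#

  conv-identityˡ : ∀ f → conv δ f ≐ f
  conv-identityˡ f []      = *-identityˡ _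
  conv-identityˡ f (x ∷ w) = ≈-trans (+-cong (*-identityˡ _) (conv-zero f w)) (+-identityʳ _)

  conv-identityʳ : ∀ f → conv f δ ≐ f
  conv-identityʳ f []      = *-identityʳ _
  conv-identityʳ f (x ∷ w) = ≈-trans (+-cong (zeroʳ _) (conv-identityʳ _ w)) (+-identityˡ _)

  conv-cancelˡ : ∀ {f f⁻¹ g h} → conv f⁻¹ f ≐ δ → conv f g ≐ conv f h → g ≐ h
  conv-cancelˡ {f} {f⁻¹} {g} {h} inv eq w = begin
    g w                       ≈⟨ undo g w ⟩
    conv f⁻¹ (conv f g) w     ≈⟨ conv-congʳ {f⁻¹} eq w ⟩
    conv f⁻¹ (conv f h) w     ≈⟨ undo h w ⟨
    h w                       ∎
    where
    undo : ∀ k → k ≐ conv f⁻¹ (conv f k)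
    undo k w = begin
      k w                     ≈⟨ conv-identityˡ k w ⟨
      conv δ k w              ≈⟨ conv-congˡ inv w ⟨
      conv (conv f⁻¹ f) k w   ≈⟨ conv-assoc f⁻¹ f k w ⟩
      conv f⁻¹ (conv f k) w   ∎

  -- The terms of a convolution other than f(w) g() only involve values of f on shorter words.
  conv-shorter : ∀ {f f′ g g′} w →
    (∀ u → length u ℕ.< length w → f u ≈ f′ u) → (∀ u → length u ℕ.≤ length w → g u ≈ g′ u) →
    conv f g w + f′ w * g′ [] ≈ conv f′ g′ w + f w * g []
  conv-shorter []      f≈ g≈ = +-comm _ _
  conv-shorter {f} {f′} {g} {g′} (x ∷ w) f≈ g≈ = begin
    f [] * g (x ∷ w) + conv (f ∘ (x ∷_)) g w + f′ (x ∷ w) * g′ []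
      ≈⟨ +-assoc _ _ _ ⟩
    f [] * g (x ∷ w) + (conv (f ∘ (x ∷_)) g w + f′ (x ∷ w) * g′ [])
      ≈⟨ +-cong (*-cong (f≈ [] (s≤s z≤n)) (g≈ (x ∷ w) ℕ.≤-refl))
           (conv-shorter w (λ u u<w → f≈ (x ∷ u) (s≤s u<w)) (λ u u≤w → g≈ u (ℕ.m≤n⇒m≤1+n u≤w))) ⟩
    f′ [] * g′ (x ∷ w) + (conv (f′ ∘ (x ∷_)) g′ w + f (x ∷ w) * g [])
      ≈⟨ +-assoc _ _ _ ⟨
    f′ [] * g′ (x ∷ w) + conv (f′ ∘ (x ∷_)) g′ w + f (x ∷ w) * g [] ∎

  -- In the square at a nonempty word, the value at the whole word occurs twice with coefficient 1
  -- and the other terms involve shorter words; so its double is determined. Right pieces are not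
  -- only tails of the same recursion, which is why the induction runs on a bound for the length.
  square-root-unique : ∀ {f g} → f [] ≈ 1# → g [] ≈ 1# → conv f f ≐ conv g g → f ≐ g
  square-root-unique {f} {g} f1 g1 eq w = go (length w) w ℕ.≤-refl
    where
    go : ∀ n w → length w ℕ.≤ n → f w ≈ g w
    go n       []      _         = ≈-trans f1 (≈-sym g1)
    -- With `cf + cg` added to both sides, the equality of the squares and `conv-shorter` each apply
    -- once, with no subtraction.
    go (suc n) (x ∷ w) (s≤s w≤n) = x+x≈y+y⇒x≈y (+-cancelʳ (cf + cg) _ _ (begin
      f xw + f xw + (cf + cg)
        ≈⟨ solve 3 (λ a b c → a :+ a :+ (b :+ c) := (a :+ b) :+ (c :+ a)) ≈-refl (f xw) cf cg ⟩
      (f xw + cf) + (cg + f xw)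
        ≈⟨ +-cong (+-congʳ (≈-sym (≈-trans (*-congʳ f1) (*-identityˡ _))))
             (+-congˡ (≈-sym (≈-trans (*-congˡ f1) (*-identityʳ _)))) ⟩
      conv f f xw + (cg + f xw * f [])
        ≈⟨ +-cong (eq xw) (≈-sym (conv-shorter w (λ u u<w → go n (x ∷ u) (ℕ.≤-trans u<w w≤n))
                                                 (λ u u≤w → go n u (ℕ.≤-trans u≤w w≤n)))) ⟩
      conv g g xw + (cf + g xw * g [])
        ≈⟨ +-cong (+-congʳ (≈-trans (*-congʳ g1) (*-identityˡ _)))
             (+-congˡ (≈-trans (*-congˡ g1) (*-identityʳ _))) ⟩
      (g xw + cg) + (cf + g xw)
        ≈⟨ solve 3 (λ a b c → (a :+ c) :+ (b :+ a) := a :+ a :+ (b :+ c)) ≈-refl (g xw) cf cg ⟩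
      g xw + g xw + (cf + cg) ∎))
      where
      xw = x ∷ w
      cf = conv (f ∘ (x ∷_)) f w
      cg = conv (g ∘ (x ∷_)) g w

  twist : (List Bool → Carrier) → List Bool → Carrier
  twist f w = [-1]^ length w * f w

  twist-cong : ∀ {f g} → f ≐ g → twist f ≐ twist g
  twist-cong f≐g w = *-congˡ (f≐g w)

  twist-involutive : ∀ f → twist (twist f) ≐ f
  twist-involutive f w = ≈-trans (≈-sym (*-assoc _ _ _))
    (≈-trans (*-congʳ ([-1]^-square (length w))) (*-identityˡ _))

  twist-conv : ∀ f g → twist (conv f g) ≐ conv (twist f) (twist g)
  twist-conv f g []      = ≈-trans (*-identityˡ _) (*-cong (≈-sym (*-identityˡ _)) (≈-sym (*-identityˡ _)))
  twist-conv f g (x ∷ w) = begin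
    (- 1# * s) * (f [] * g (x ∷ w) + conv f′ g w)
      ≈⟨ solve 5 (λ t s a b c → (t :* s) :* (a :* b :+ c) := a :* ((t :* s) :* b) :+ t :* (s :* c))
           ≈-refl (- 1#) s (f []) (g (x ∷ w)) (conv f′ g w) ⟩
    f [] * ((- 1# * s) * g (x ∷ w)) + - 1# * (s * conv f′ g w)
      ≈⟨ +-cong (*-congʳ (≈-sym (*-identityˡ _))) (*-congˡ (twist-conv f′ g w)) ⟩
    (1# * f []) * twist g (x ∷ w) + - 1# * conv (twist f′) (twist g) w
      ≈⟨ +-congˡ (≈-trans (≈-sym (conv-* (- 1#) (twist f′) (twist g) w))
           (conv-congˡ (λ u → ≈-sym (*-assoc _ _ _)) w)) ⟩
    (1# * f []) * twist g (x ∷ w) + conv (twist f ∘ (x ∷_)) (twist g) w ∎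
    where
    s  = [-1]^ length w
    f′ = f ∘ (x ∷_)

  -- Coefficients of (1 + x)(1 - x²)^(p - 1/2) and their convolutions

  -- The coefficient of x^m in (1 - x)^(-1/2).
  centralTerm : ℕ → Carrier
  centralTerm m = ι (central m) /2^ (2 ℕ.* m)

  -- γ p n is the coefficient of xⁿ in (1 + x) (1 - x²)^(p - 1/2).
  γ : ℕ → ℕ → Carrier
  γ zero    n             = centralTerm ⌊ n /2⌋
  γ (suc p) zero          = 1#
  γ (suc p) (suc zero)    = 1#
  γ (suc p) (suc (suc n)) = γ p (suc (suc n)) - γ p n

  centralTerm-0 : centralTerm 0 ≈ 1#
  centralTerm-0 = ≈-trans (*-identityʳ _) (+-identityʳ 1#)

  γ-0 : ∀ p → γ p 0 ≈ 1#
  γ-0 zero    = centralTerm-0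
  γ-0 (suc p) = ≈-refl

  γ-1 : ∀ p → γ p 1 ≈ 1#
  γ-1 zero    = centralTerm-0
  γ-1 (suc p) = ≈-refl

  γ-step : ∀ p n → γ (suc p) (suc (suc n)) + γ p n ≈ γ p (suc (suc n))
  γ-step p n = x-y+y≈x _ _

  -- The power of 1 - x² is even in x, and the factor 1 + x copies each of its coefficients to the
  -- next odd degree.
  γ-even : ∀ p n → even? n ≡ true → γ p (suc n) ≈ γ p n
  γ-even zero    n             ev = reflexive (cong centralTerm (⌊1+n/2⌋≡⌊n/2⌋ n ev))
  γ-even (suc p) zero          ev = ≈-refl
  γ-even (suc p) (suc (suc n)) ev = +-cong (γ-even p (suc (suc n)) ev) (-‿cong (γ-even p n ev))

  -- The recursion of `γ` in p is `C-Pascal` divided by a power of 4; the sign turns its sum into a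
  -- difference.
  γ-closed : ∀ p n → p ℕ.≤ ⌊ n /2⌋ →
             γ p n ≈ [-1]^ p * ι (C p (⌊ n /2⌋ ∸ p)) /2^ (2 ℕ.* ⌊ n /2⌋)
  γ-closed zero    n             _         = *-congʳ (≈-sym (*-identityˡ _))
  γ-closed (suc p) (suc (suc n)) (s≤s p≤m) = +-cancelʳ (γ p n) _ _ (begin
    γ (suc p) (suc (suc n)) + γ p n
      ≈⟨ γ-step p n ⟩
    γ p (suc (suc n))
      ≈⟨ γ-closed p (suc (suc n)) (ℕ.m≤n⇒m≤1+n p≤m) ⟩
    s * ι (C p (suc m ∸ p)) * y
      ≡⟨ cong (λ k → s * ι (C p k) * y) (ℕ.+-∸-assoc 1 p≤m) ⟩
    s * b * y
      ≈⟨ +-identityʳ _ ⟨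
    s * b * y + 0#
      -- The inserted zero is C(p + 1, q) with both signs: the negative copy is the value sought,
      -- and the positive one joins `b` in `C-Pascal`.
      ≈⟨ +-congˡ (≈-trans (*-congʳ -1+1≈0) (zeroˡ _)) ⟨
    s * b * y + (- 1# + 1#) * (s * d * y)
      ≈⟨ +-congˡ (≈-trans (distribʳ _ _ _) (+-congˡ (*-identityˡ _))) ⟩
    s * b * y + (- 1# * (s * d * y) + s * d * y)
      ≈⟨ solve 5 (λ t s b d y → s :* b :* y :+ (t :* (s :* d :* y) :+ s :* d :* y)
           := t :* s :* d :* y :+ s :* ((b :+ d) :* y)) ≈-refl (- 1#) s b d y ⟩
    - 1# * s * d * y + s * ((b + d) * y)
      ≈⟨ +-congˡ (*-congˡ (*-congʳ (ι-+ (C p (suc q)) (C (suc p) q)))) ⟨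
    - 1# * s * d * y + s * (ι (C p (suc q) ℕ.+ C (suc p) q) * y)
      ≡⟨ cong (λ k → - 1# * s * d * y + s * (ι k * y)) (C-Pascal p q) ⟩
    - 1# * s * d * y + s * (ι (4 ℕ.* C p q) * y)
      ≈⟨ +-congˡ (≈-trans (*-congˡ (ι-4*-/2^ (C p q) m)) (≈-sym (*-assoc _ _ _))) ⟩
    - 1# * s * d * y + s * ι (C p q) /2^ (2 ℕ.* m)
      ≈⟨ +-congˡ (γ-closed p n p≤m) ⟨
    - 1# * s * d * y + γ p n ∎)
    where
    m = ⌊ n /2⌋
    q = m ∸ p
    s = [-1]^ p
    b = ι (C p (suc q))
    d = ι (C (suc p) q)
    y = ½ ^ (2 ℕ.* suc m)

  -- Σⱼ γ s (i + j) * γ q (m ∸ j) over 0 ≤ j ≤ m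
  γ-conv : ℕ → ℕ → ℕ → ℕ → Carrier
  γ-conv s q i zero    = γ s i * γ q 0
  γ-conv s q i (suc m) = γ s i * γ q (suc m) + γ-conv s q (suc i) m

  -- This multiplies the second series by 1 - x². The last two terms of the sum are not affected
  -- because its coefficients of degree 0 and 1 are 1 for every q.
  γ-conv-suc : ∀ s q i m →
               γ-conv s (suc q) i (2 ℕ.+ m) + γ-conv s q i m ≈ γ-conv s q i (2 ℕ.+ m)
  γ-conv-suc s q i zero = begin
    (x * γ (suc q) 2 + (y * 1# + z * 1#)) + x * γ q 0
      ≈⟨ solve 6 (λ x y z a b o → (x :* a :+ (y :* o :+ z :* o)) :+ x :* b :=
                                  x :* (a :+ b) :+ (y :* o :+ z :* o))
           ≈-refl x y z (γ (suc q) 2) (γ q 0) 1# ⟩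
    x * (γ (suc q) 2 + γ q 0) + (y * 1# + z * 1#)
      ≈⟨ +-cong (*-congˡ (γ-step q 0))
           (+-cong (*-congˡ (≈-sym (γ-1 q))) (*-congˡ (≈-sym (γ-0 q)))) ⟩
    x * γ q 2 + (y * γ q 1 + z * γ q 0) ∎
    where
    x = γ s i
    y = γ s (suc i)
    z = γ s (suc (suc i))
  γ-conv-suc s q i (suc m) = begin
    (x * a + v) + (x * b + v′)
      ≈⟨ solve 5 (λ x a b v v′ → (x :* a :+ v) :+ (x :* b :+ v′) := x :* (a :+ b) :+ (v :+ v′))
           ≈-refl x a b v v′ ⟩
    x * (a + b) + (v + v′)
      ≈⟨ +-cong (*-congˡ (γ-step q (suc m))) (γ-conv-suc s q (suc i) m) ⟩
    x * γ q (3 ℕ.+ m) + γ-conv s q (suc i) (2 ℕ.+ m) ∎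
    where
    x  = γ s i
    a  = γ (suc q) (3 ℕ.+ m)
    b  = γ q (suc m)
    v  = γ-conv s (suc q) (suc i) (2 ℕ.+ m)
    v′ = γ-conv s q (suc i) m

  -- The identity behind sliding a factor DA along a word.
  γ-conv-move : ∀ s q i m → γ-conv s (suc q) i (2 ℕ.+ m) ≈
    γ s i * γ q (2 ℕ.+ m) + (γ s (suc i) * γ q (suc m) + γ-conv (suc s) q (2 ℕ.+ i) m)
  γ-conv-move s q i zero = begin
    a * b + (d * 1# + γ s (2 ℕ.+ i) * 1#)
      ≈⟨ +-congˡ (+-cong (*-congˡ (≈-sym (γ-1 q)))
           (*-cong (≈-sym (γ-step s i)) (≈-sym (γ-0 q)))) ⟩
    a * b + (d * γ q 1 + (y + a) * e)
      ≈⟨ solve 5 (λ a b x y e → a :* b :+ (x :+ (y :+ a) :* e) := a :* (b :+ e) :+ (x :+ y :* e))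
           ≈-refl a b (d * γ q 1) y e ⟩
    a * (b + e) + (d * γ q 1 + y * e)
      ≈⟨ +-congʳ (*-congˡ (γ-step q 0)) ⟩
    a * γ q 2 + (d * γ q 1 + y * e) ∎
    where
    a = γ s i
    b = γ (suc q) 2
    d = γ s (suc i)
    e = γ q 0
    y = γ (suc s) (2 ℕ.+ i)
  γ-conv-move s q i (suc m) = begin
    a * b + γ-conv s (suc q) (suc i) (2 ℕ.+ m)
      ≈⟨ +-congˡ (γ-conv-move s q (suc i) m) ⟩
    a * b + (x + (γ s (2 ℕ.+ i) * e + t))
      ≈⟨ +-congˡ (+-congˡ (+-congʳ (*-congʳ (γ-step s i)))) ⟨
    a * b + (x + ((y + a) * e + t))
      ≈⟨ solve 6 (λ a b x y e t → a :* b :+ (x :+ ((y :+ a) :* e :+ t)) :=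
                                  a :* (b :+ e) :+ (x :+ (y :* e :+ t))) ≈-refl a b x y e t ⟩
    a * (b + e) + (x + (y * e + t))
      ≈⟨ +-congʳ (*-congˡ (γ-step q (suc m))) ⟩
    a * γ q (3 ℕ.+ m) + (x + (y * e + t)) ∎
    where
    a = γ s i
    b = γ (suc q) (3 ℕ.+ m)
    e = γ q (suc m)
    x = γ s (suc i) * γ q (2 ℕ.+ m)
    y = γ (suc s) (2 ℕ.+ i)
    t = γ-conv (suc s) q (3 ℕ.+ i) m

  centralConv : ℕ → ℕ → Carrier
  centralConv i zero    = centralTerm i * centralTerm 0
  centralConv i (suc j) = centralTerm i * centralTerm (suc j) + centralConv (suc i) j

  -- The hypothesis says that i is even. The terms whose left index is even form the first
  -- convolution and those with odd left index the second, so the recursion takes two terms at a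
  -- time.
  γ-conv-00 : ∀ i m → ⌊ suc i /2⌋ ≡ ⌊ i /2⌋ →
    γ-conv 0 0 i (suc m) ≈ centralConv ⌊ i /2⌋ ⌊ suc m /2⌋ + centralConv ⌊ i /2⌋ ⌊ m /2⌋
  γ-conv-00 i 0 eq rewrite eq = ≈-refl
  γ-conv-00 i 1 eq rewrite eq =
    solve 3 (λ x y z → x :+ (y :+ z) := x :+ z :+ y) ≈-refl _ _ _
  γ-conv-00 i (suc (suc m)) eq = begin
    x * y + (γ 0 (suc i) * z + γ-conv 0 0 (2 ℕ.+ i) (suc m))
      ≡⟨ cong (λ k → x * y + (centralTerm k * z + γ-conv 0 0 (2 ℕ.+ i) (suc m))) eq ⟩
    x * y + (x * z + γ-conv 0 0 (2 ℕ.+ i) (suc m))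
      ≈⟨ +-congˡ (+-congˡ (γ-conv-00 (2 ℕ.+ i) m (cong suc eq))) ⟩
    x * y + (x * z + (u + v))
      ≈⟨ solve 4 (λ a b u v → a :+ (b :+ (u :+ v)) := (a :+ u) :+ (b :+ v)) ≈-refl _ _ _ _ ⟩
    (x * y + u) + (x * z + v) ∎
    where
    x = γ 0 i
    y = γ 0 (3 ℕ.+ m)
    z = γ 0 (2 ℕ.+ m)
    u = centralConv ⌊ 2 ℕ.+ i /2⌋ ⌊ suc m /2⌋
    v = centralConv ⌊ 2 ℕ.+ i /2⌋ ⌊ m /2⌋

  centralTerm-* : ∀ i j → centralTerm i * centralTerm j ≈
                  ι (central i ℕ.* central j) /2^ (2 ℕ.* i ℕ.+ 2 ℕ.* j)
  centralTerm-* i j = begin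
    ι (central i) * ½ ^ (2 ℕ.* i) * (ι (central j) * ½ ^ (2 ℕ.* j))
      ≈⟨ solve 4 (λ a x b y → a :* x :* (b :* y) := a :* b :* (x :* y)) ≈-refl _ _ _ _ ⟩
    ι (central i) * ι (central j) * (½ ^ (2 ℕ.* i) * ½ ^ (2 ℕ.* j))
      ≈⟨ *-cong (×1-homo-* (central i) (central j)) (^-homo-* ½ (2 ℕ.* i) (2 ℕ.* j)) ⟨
    ι (central i ℕ.* central j) * ½ ^ (2 ℕ.* i ℕ.+ 2 ℕ.* j) ∎

  centralConv≈ : ∀ i j → centralConv i j ≈ ι (partialConv i j) /2^ (2 ℕ.* i ℕ.+ 2 ℕ.* j)
  centralConv≈ i zero    = centralTerm-* i 0
  centralConv≈ i (suc j) = begin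
    centralTerm i * centralTerm (suc j) + centralConv (suc i) j
      ≈⟨ +-cong (centralTerm-* i (suc j)) (centralConv≈ (suc i) j) ⟩
    ι x * ½ ^ (2 ℕ.* i ℕ.+ 2 ℕ.* suc j) + ι y * ½ ^ (2 ℕ.* suc i ℕ.+ 2 ℕ.* j)
      ≡⟨ cong (λ k → ι x * ½ ^ (2 ℕ.* i ℕ.+ 2 ℕ.* suc j) + ι y * ½ ^ k) (shift i j) ⟩
    ι x * ½ ^ (2 ℕ.* i ℕ.+ 2 ℕ.* suc j) + ι y * ½ ^ (2 ℕ.* i ℕ.+ 2 ℕ.* suc j)
      ≈⟨ distribʳ _ _ _ ⟨
    (ι x + ι y) * ½ ^ (2 ℕ.* i ℕ.+ 2 ℕ.* suc j)
      ≈⟨ *-congʳ (ι-+ x y) ⟨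
    ι (x ℕ.+ y) * ½ ^ (2 ℕ.* i ℕ.+ 2 ℕ.* suc j) ∎
    where
    x = central i ℕ.* central (suc j)
    y = partialConv (suc i) j
    shift : ∀ i j → 2 ℕ.* suc i ℕ.+ 2 ℕ.* j ≡ 2 ℕ.* i ℕ.+ 2 ℕ.* suc j
    shift = solve-∀

  centralConv-0 : ∀ j → centralConv 0 j ≈ 1#
  centralConv-0 j = ≈-trans (centralConv≈ 0 j)
    (≈-trans (reflexive (cong (λ k → ι k /2^ (2 ℕ.* j)) (partialConv-0 j))) (powers j))
    where
    powers : ∀ j → ι (4 ℕ.^ j) /2^ (2 ℕ.* j) ≈ 1#
    powers zero    = centralTerm-0
    powers (suc j) = ≈-trans (ι-4*-/2^ (4 ℕ.^ j) j) (powers j)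

  [_≡0] : ℕ → Carrier
  [ zero  ≡0] = 1#
  [ suc _ ≡0] = 0#

  -- For p = 0 the product is (1 + x)/(1 - x), with coefficient 2 in every positive degree. Each
  -- further factor 1 - x² takes the difference of two coefficients that are equal by induction, as
  -- long as the lower degree stays in range.
  γ-conv-total : ∀ p m → 2 ℕ.* p ℕ.≤ m → γ-conv 0 p 0 (suc m) ≈ [ p ≡0] + [ p ≡0]
  γ-conv-total zero    m _ = ≈-trans (γ-conv-00 0 m refl)
    (+-cong (centralConv-0 ⌊ suc m /2⌋) (centralConv-0 ⌊ m /2⌋))
  γ-conv-total (suc p) m 2p+2≤m
    with m | subst (ℕ._≤ m) (ℕ.*-suc 2 p) 2p+2≤m
  ... | suc (suc m) | s≤s (s≤s 2p≤m) = +-cancelʳ (γ-conv 0 p 0 (suc m)) _ _ (begin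
    γ-conv 0 (suc p) 0 (3 ℕ.+ m) + γ-conv 0 p 0 (suc m)
      ≈⟨ γ-conv-suc 0 p 0 (suc m) ⟩
    γ-conv 0 p 0 (3 ℕ.+ m)
      ≈⟨ γ-conv-total p (2 ℕ.+ m) (ℕ.m≤n⇒m≤1+n (ℕ.m≤n⇒m≤1+n 2p≤m)) ⟩
    [ p ≡0] + [ p ≡0]
      ≈⟨ γ-conv-total p m 2p≤m ⟨
    γ-conv 0 p 0 (suc m)
      ≈⟨ +-identityˡ _ ⟨
    0# + γ-conv 0 p 0 (suc m)
      ≈⟨ +-congʳ (+-identityˡ 0#) ⟨
    0# + 0# + γ-conv 0 p 0 (suc m) ∎)

  -- The square of the candidate root

  Γ : List Bool → Carrier
  Γ []      = 1#
  Γ (_ ∷ w) = γ (countDA false w) (suc (length w))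

  -- The value of `Γ` on a left piece of which i letters, with s factors DA and last letter b, have
  -- been read and u is still to come.
  γ-word : Bool → ℕ → ℕ → List Bool → Carrier
  γ-word b s i u = γ (s ℕ.+ countDA b u) (i ℕ.+ length u)

  conv-γ-word-∷ : ∀ b x s i k w → (∀ u → countDA b (x ∷ u) ≡ k ℕ.+ countDA x u) →
    conv (γ-word b s i) Γ (x ∷ w) ≈
    γ s i * γ (countDA false w) (suc (length w)) + conv (γ-word x (s ℕ.+ k) (suc i)) Γ w
  conv-γ-word-∷ b x s i k w eq = +-cong
    (*-congʳ (reflexive (cong₂ γ (ℕ.+-identityʳ s) (ℕ.+-identityʳ i))))
    (conv-congˡ (λ u → reflexive (cong₂ γ
       (≡.trans (cong (s ℕ.+_) (eq u)) (≡.sym (ℕ.+-assoc s k (countDA x u)))) (ℕ.+-suc i (length u)))) w)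

  -- On the right, all factors DA of w are credited to the right piece whatever the cut; each of
  -- them is moved there by `γ-conv-move`.
  conv-γ-false : ∀ s i w → conv (γ-word false s i) Γ w ≈ γ-conv s (countDA false w) i (length w)
  conv-γ-true  : ∀ b s i w →
    conv (γ-word b s i) Γ (true ∷ w) ≈ γ-conv s (countDA true w) i (suc (length w))

  conv-γ-false s i []          = *-cong
    (reflexive (cong₂ γ (ℕ.+-identityʳ s) (ℕ.+-identityʳ i))) (≈-sym (γ-0 0))
  conv-γ-false s i (true  ∷ w) = conv-γ-true false s i w
  conv-γ-false s i (false ∷ w) = ≈-trans (conv-γ-word-∷ false false s i 0 w (λ _ → refl))
    (+-congˡ (≈-trans (conv-γ-false (s ℕ.+ 0) (suc i) w)
      (reflexive (cong (λ s → γ-conv s (countDA false w) (suc i) (length w)) (ℕ.+-identityʳ s)))))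

  conv-γ-true b s i w = ≈-trans (conv-γ-word-∷ b true s i 0 w (λ _ → refl))
    (≈-trans (reflexive (cong (λ s′ → γ s i * γ (countDA false w) (suc (length w)) +
                                conv (γ-word true s′ (suc i)) Γ w) (ℕ.+-identityʳ s)))
             (rest w))
    where
    rest : ∀ w → γ s i * γ (countDA false w) (suc (length w)) + conv (γ-word true s (suc i)) Γ w ≈
                 γ-conv s (countDA true w) i (suc (length w))
    rest []          = +-congˡ (*-cong
      (reflexive (cong₂ γ (ℕ.+-identityʳ s) (cong suc (ℕ.+-identityʳ i)))) (≈-sym (γ-0 0)))
    rest (true  ∷ w) = +-congˡ (conv-γ-true true s (suc i) w)
    -- The cuts before D and before A leave s factors on the left and q on the right; every later
    -- cut has this DA on the left. These are the summands of `γ-conv-move`.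
    rest (false ∷ w) = begin
      γ s i * γ q (2 ℕ.+ m) + conv (γ-word true s (suc i)) Γ (false ∷ w)
        ≈⟨ +-congˡ (conv-γ-word-∷ true false s (suc i) 1 w (λ _ → refl)) ⟩
      γ s i * γ q (2 ℕ.+ m) +
        (γ s (suc i) * γ q (suc m) + conv (γ-word false (s ℕ.+ 1) (2 ℕ.+ i)) Γ w)
        ≈⟨ +-congˡ (+-congˡ (conv-γ-false (s ℕ.+ 1) (2 ℕ.+ i) w)) ⟩
      γ s i * γ q (2 ℕ.+ m) + (γ s (suc i) * γ q (suc m) + γ-conv (s ℕ.+ 1) q (2 ℕ.+ i) m)
        ≡⟨ cong (λ s′ → γ s i * γ q (2 ℕ.+ m) + (γ s (suc i) * γ q (suc m) + γ-conv s′ q (2 ℕ.+ i) m))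
             (ℕ.+-comm s 1) ⟩
      γ s i * γ q (2 ℕ.+ m) + (γ s (suc i) * γ q (suc m) + γ-conv (suc s) q (2 ℕ.+ i) m)
        ≈⟨ γ-conv-move s q i m ⟨
      γ-conv s (suc q) i (2 ℕ.+ m) ∎
      where
      q = countDA false w
      m = length w

  Γ-square : ∀ x w → conv Γ Γ (x ∷ w) ≈ [ countDA false w ≡0] + [ countDA false w ≡0]
  Γ-square x w = ≈-trans
    -- The empty left piece is the term of index 0, its value 1 being `γ 0 0`; the other left pieces
    -- contain the dummy letter and so start at length 1.
    (+-cong (*-congʳ (≈-sym (γ-0 0))) (conv-γ-false 0 1 w))
    (γ-conv-total (countDA false w) (length w) (2*countDA-false≤ w))

  -- The universal character and its inverse on words

  -- The values of ζ and of the conjugate of ζ⁻¹ on the fundamental basis.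

  [allAscents] [allDescents] : List Bool → Carrier
  [allAscents] []          = 1#
  [allAscents] (false ∷ w) = [allAscents] w
  [allAscents] (true  ∷ w) = 0#
  [allDescents] []          = 1#
  [allDescents] (false ∷ w) = 0#
  [allDescents] (true  ∷ w) = [allDescents] w

  Z Z̄⁻¹ : List Bool → Carrier
  Z []        = 1#
  Z (_ ∷ w)   = [allAscents] w
  Z̄⁻¹ []      = 1#
  Z̄⁻¹ (_ ∷ w) = [allDescents] w

  conv-allAscents : ∀ f w → conv [allAscents] f (false ∷ w) ≈ f (false ∷ w) + conv [allAscents] f w
  conv-allAscents f w = +-congʳ (*-identityˡ _)

  conv-allAscents-true : ∀ f w → conv [allAscents] f (true ∷ w) ≈ f (true ∷ w)
  conv-allAscents-true f w = ≈-trans (+-cong (*-identityˡ _) (conv-zero f w)) (+-identityʳ _)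

  conv-Z : ∀ f x w → conv Z f (x ∷ w) ≈ f (x ∷ w) + conv [allAscents] f w
  conv-Z f x w = +-congʳ (*-identityˡ _)

  -- Only cuts between a run of ascents and a run of descents survive. Since a cut drops one letter,
  -- a word A⋯AD⋯D has two such cuts, at adjacent places and thus with opposite signs.
  conv-Z-twist : conv Z (twist Z̄⁻¹) ≐ δ
  conv-Z-twist []      = ≈-trans (*-identityˡ _) (*-identityˡ _)
  conv-Z-twist (x ∷ w) = ≈-trans (conv-Z (twist Z̄⁻¹) x w)
    (≈-trans (+-congˡ (go w)) (cancel ([-1]^ length w) ([allDescents] w)))
    where
    cancel : ∀ s d → - 1# * s * d + s * d ≈ 0#
    cancel s d = begin
      - 1# * s * d + s * d           ≈⟨ +-cong (*-assoc _ _ _) (≈-sym (*-identityˡ _)) ⟩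
      - 1# * (s * d) + 1# * (s * d)  ≈⟨ distribʳ (s * d) (- 1#) 1# ⟨
      (- 1# + 1#) * (s * d)          ≈⟨ *-congʳ -1+1≈0 ⟩
      0# * (s * d)                   ≈⟨ zeroˡ _ ⟩
      0#                             ∎
    go : ∀ w → conv [allAscents] (twist Z̄⁻¹) w ≈ [-1]^ length w * [allDescents] w
    go []          = *-identityˡ _
    go (true  ∷ w) = conv-allAscents-true (twist Z̄⁻¹) w
    go (false ∷ w) = ≈-trans (conv-allAscents (twist Z̄⁻¹) w)
      (≈-trans (+-congˡ (go w)) (≈-trans (cancel ([-1]^ length w) ([allDescents] w)) (≈-sym (zeroʳ _))))

  allDescents≈ : ∀ w → [allDescents] w ≈ [ countDA true w ≡0]
  allDescents≈ []          = ≈-refl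
  allDescents≈ (true  ∷ w) = allDescents≈ w
  allDescents≈ (false ∷ w) = ≈-refl

  -- On the right the two cuts of `conv-Z-twist` survive again, now with equal signs.
  Γ-square≐ : conv Γ Γ ≐ conv Z Z̄⁻¹
  Γ-square≐ []      = ≈-refl
  Γ-square≐ (x ∷ w) = ≈-trans (Γ-square x w) (≈-sym (≈-trans (conv-Z Z̄⁻¹ x w) (go w)))
    where
    go : ∀ w → [allDescents] w + conv [allAscents] Z̄⁻¹ w ≈ [ countDA false w ≡0] + [ countDA false w ≡0]
    go []          = +-congˡ (*-identityˡ _)
    go (true  ∷ w) = +-cong (allDescents≈ w) (≈-trans (conv-allAscents-true Z̄⁻¹ w) (allDescents≈ w))
    go (false ∷ w) = ≈-trans (+-identityˡ _) (≈-trans (conv-allAscents Z̄⁻¹ w) (go w))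

  -- The even part, and uniqueness of both parts

  γ-evenPart : ℕ → ℕ → Carrier
  γ-evenPart p n = if even? n then γ p n else 0#

  evenPart-+ : ∀ p n → γ-evenPart p n + γ-evenPart p (suc n) ≈ γ p (suc n)
  evenPart-+ p n with even? n in ev | even? (suc n) | even?-suc n
  ... | true  | _ | refl = ≈-trans (+-identityʳ _) (≈-sym (γ-even p n ev))
  ... | false | _ | refl = +-identityˡ _

  evenPart-suc : ∀ p n → γ-evenPart (suc p) (suc n) + γ p n ≈ γ p (suc n)
  evenPart-suc p zero    = ≈-trans (+-identityˡ _) (≈-trans (γ-0 p) (≈-sym (γ-1 p)))
  evenPart-suc p (suc n) with even? n in ev
  ... | true  = ≈-trans (+-congˡ (γ-even p n ev)) (γ-step p n)
  ... | false = ≈-trans (+-identityˡ _)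
    (≈-sym (γ-even p (suc n) (≡.trans (even?-suc n) (cong not ev))))

  Γ₊ : List Bool → Carrier
  Γ₊ []      = 1#
  Γ₊ (_ ∷ w) = γ-evenPart (countDA true w) (suc (length w))

  -- The left piece can only grow along the initial ascents. Each ascent adds a term with one more
  -- DA, absorbed by `evenPart-suc`; the first descent ends the sum with two consecutive degrees, of
  -- which `evenPart-+` keeps the even one.
  conv-Z-Γ₊ : conv Z Γ₊ ≐ Γ
  conv-Z-Γ₊ []      = *-identityˡ 1#
  conv-Z-Γ₊ (x ∷ w) = ≈-trans (conv-Z Γ₊ x w) (go w)
    where
    go : ∀ w → γ-evenPart (countDA true w) (suc (length w)) + conv [allAscents] Γ₊ w ≈
               γ (countDA false w) (suc (length w))
    go []          = ≈-trans (+-identityˡ _) (≈-trans (*-identityˡ 1#) (≈-sym (γ-1 0)))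
    go (true  ∷ w) = ≈-trans (+-congˡ (conv-allAscents-true Γ₊ w))
      (≈-trans (+-comm _ _) (evenPart-+ (countDA true w) (suc (length w))))
    go (false ∷ w) = ≈-trans (+-congˡ (≈-trans (conv-allAscents Γ₊ w) (go w)))
      (evenPart-suc (countDA false w) (suc (length w)))

  -- Multiplying `conv Z y ≐ δ` by `ȳ₋` on the right cancels `y₋` by oddness and leaves `conv Z y₊`.
  -- Twisting `factors` fixes `y₊`, so a second `ȳ₋` completes it to `twist y`. The factors do not
  -- commute, and this order is respected throughout.
  even-odd-parts : ∀ {y y₊ y₋} → conv Z y ≐ δ → conv y Z ≐ δ →
    y₊ [] ≈ 1# → y₋ [] ≈ 1# → y ≐ conv y₊ y₋ → twist y₊ ≐ y₊ →
    conv y₋ (twist y₋) ≐ δ → (y₊ ≐ Γ₊) × (twist y₋ ≐ Γ)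
  even-odd-parts {y} {y₊} {y₋} Zy yZ y₊1 y₋1 factors even odd = y₊≐ , ȳ₋≐
    where
    ȳ₋ = twist y₋

    ȳ≐ : twist y ≐ Z̄⁻¹
    ȳ≐ w = ≈-trans
      (twist-cong (conv-cancelˡ {Z} {y} {y} {twist Z̄⁻¹} yZ (λ w → ≈-trans (Zy w) (≈-sym (conv-Z-twist w)))) w)
      (twist-involutive Z̄⁻¹ w)

    Zy₊≐ȳ₋ : conv Z y₊ ≐ ȳ₋
    Zy₊≐ȳ₋ w = begin
      conv Z y₊ w                       ≈⟨ conv-identityʳ (conv Z y₊) w ⟨
      conv (conv Z y₊) δ w              ≈⟨ conv-congʳ {conv Z y₊} odd w ⟨
      conv (conv Z y₊) (conv y₋ ȳ₋) w   ≈⟨ conv-assoc (conv Z y₊) y₋ ȳ₋ w ⟨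
      conv (conv (conv Z y₊) y₋) ȳ₋ w   ≈⟨ conv-congˡ (conv-assoc Z y₊ y₋) w ⟩
      conv (conv Z (conv y₊ y₋)) ȳ₋ w   ≈⟨ conv-congˡ (conv-congʳ {Z} factors) w ⟨
      conv (conv Z y) ȳ₋ w              ≈⟨ conv-congˡ Zy w ⟩
      conv δ ȳ₋ w                       ≈⟨ conv-identityˡ ȳ₋ w ⟩
      ȳ₋ w                              ∎

    ȳ₋²≐ : conv ȳ₋ ȳ₋ ≐ conv Γ Γ
    ȳ₋²≐ w = begin
      conv ȳ₋ ȳ₋ w                      ≈⟨ conv-congˡ Zy₊≐ȳ₋ w ⟨
      conv (conv Z y₊) ȳ₋ w             ≈⟨ conv-assoc Z y₊ ȳ₋ w ⟩
      conv Z (conv y₊ ȳ₋) w             ≈⟨ conv-congʳ {Z} (conv-congˡ even) w ⟨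
      conv Z (conv (twist y₊) ȳ₋) w     ≈⟨ conv-congʳ {Z} (twist-conv y₊ y₋) w ⟨
      conv Z (twist (conv y₊ y₋)) w     ≈⟨ conv-congʳ {Z} (twist-cong factors) w ⟨
      conv Z (twist y) w                ≈⟨ conv-congʳ {Z} ȳ≐ w ⟩
      conv Z Z̄⁻¹ w                      ≈⟨ Γ-square≐ w ⟨
      conv Γ Γ w                        ∎

    ȳ₋≐ : ȳ₋ ≐ Γ
    ȳ₋≐ = square-root-unique (≈-trans (*-identityˡ _) y₋1) ≈-refl ȳ₋²≐

    y₊≐ : y₊ ≐ Γ₊
    y₊≐ = conv-cancelˡ {Z} {y} yZ
      (λ w → ≈-trans (Zy₊≐ȳ₋ w) (≈-trans (ȳ₋≐ w) (≈-sym (conv-Z-Γ₊ w))))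

  -- Sums over refinements

  ∑-filter : ∀ {a p} {A : Set a} {P : Pred A p} (P? : Decidable P) xs f →
             ∑ (filter P? xs) f ≈ ∑ xs (λ x → if does (P? x) then f x else 0#)
  ∑-filter P? []       f = ≈-refl
  ∑-filter P? (x ∷ xs) f with does (P? x)
  ... | true  = +-congˡ (∑-filter P? xs f)
  ... | false = ≈-trans (∑-filter P? xs f) (≈-sym (+-identityˡ _))

  ∑-last : ∀ N h → (∀ m → m ℕ.< N → h m ≈ 0#) → ∑ (upTo (suc N)) h ≈ h N
  ∑-last N h h≈0 = begin
    ∑ (upTo (suc N)) h          ≡⟨ cong (λ ms → ∑ ms h) (List.upTo-∷ʳ N) ⟨
    ∑ (upTo N ∷ʳ N) h           ≈⟨ ∑-++ (upTo N) [ N ] h ⟩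
    ∑ (upTo N) h + (h N + 0#)   ≈⟨ +-cong (below N h≈0) (+-identityʳ (h N)) ⟩
    0# + h N                    ≈⟨ +-identityˡ (h N) ⟩
    h N                         ∎
    where
    below : ∀ N → (∀ m → m ℕ.< N → h m ≈ 0#) → ∑ (upTo N) h ≈ 0#
    below zero    _   = ≈-refl
    below (suc N) h≈0 = ∑-zero {f = h} (all-upTo N (λ m m≤N → h≈0 m (s≤s m≤N)))

  ∑-words-suc : ∀ n f → ∑ (words (suc n)) f ≈ ∑ (words n) (λ v → f (true ∷ v) + f (false ∷ v))
  ∑-words-suc n f = ≈-trans (∑-concatMap _ (words n) f)
    (∑-cong (words n) (λ v → +-congˡ (+-identityʳ _)))

  ∑-compositions : ∀ n f → ∑ (compositions (suc n)) f ≈ ∑ (words n) (f ∘ ribbon)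
  ∑-compositions n f = ≈-trans (reflexive (cong (λ αs → ∑ αs f) (compositions-ribbon n)))
    (∑-map ribbon (words n) f)

  -- Refining a composition turns some ascents of its word into descents.
  refinementSum : (List Bool → Carrier) → List Bool → Carrier
  refinementSum f []          = f []
  refinementSum f (true  ∷ w) = refinementSum (f ∘ (true ∷_)) w
  refinementSum f (false ∷ w) = refinementSum (f ∘ (true ∷_)) w + refinementSum (f ∘ (false ∷_)) w

  refinementSum-cong : ∀ {f g} → f ≐ g → refinementSum f ≐ refinementSum g
  refinementSum-cong f≐g []          = f≐g []
  refinementSum-cong f≐g (true  ∷ w) = refinementSum-cong (f≐g ∘ (true ∷_)) w
  refinementSum-cong f≐g (false ∷ w) =
    +-cong (refinementSum-cong (f≐g ∘ (true ∷_)) w) (refinementSum-cong (f≐g ∘ (false ∷_)) w)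

  refinementSum-+ : ∀ f g w → refinementSum (λ u → f u + g u) w ≈ refinementSum f w + refinementSum g w
  refinementSum-+ f g []          = ≈-refl
  refinementSum-+ f g (true  ∷ w) = refinementSum-+ _ _ w
  refinementSum-+ f g (false ∷ w) = ≈-trans (+-cong (refinementSum-+ _ _ w) (refinementSum-+ _ _ w))
    (solve 4 (λ a b c d → (a :+ b) :+ (c :+ d) := (a :+ c) :+ (b :+ d)) ≈-refl _ _ _ _)

  refinementSum-* : ∀ k f w → refinementSum (λ u → k * f u) w ≈ k * refinementSum f w
  refinementSum-* k f []          = ≈-refl
  refinementSum-* k f (true  ∷ w) = refinementSum-* k _ w
  refinementSum-* k f (false ∷ w) = ≈-trans (+-cong (refinementSum-* k _ w) (refinementSum-* k _ w))
    (≈-sym (distribˡ k _ _))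

  refinementSum-0 : ∀ w → refinementSum (λ _ → 0#) w ≈ 0#
  refinementSum-0 []          = ≈-refl
  refinementSum-0 (true  ∷ w) = refinementSum-0 w
  refinementSum-0 (false ∷ w) = ≈-trans (+-cong (refinementSum-0 w) (refinementSum-0 w)) (+-identityˡ 0#)

  ∑-refinements : ∀ w f →
    ∑ (words (length w)) (λ v → if refines v w then f v else 0#) ≈ refinementSum f w
  ∑-refinements []          f = +-identityʳ _
  ∑-refinements (true  ∷ w) f = begin
    ∑ (words (suc n)) (λ v → if refines v (true ∷ w) then f v else 0#)
      ≈⟨ ∑-words-suc n _ ⟩
    ∑ (words n) (λ v → (if refines (true ∷ v) (true ∷ w) then f (true ∷ v) else 0#) +
                       (if refines (false ∷ v) (true ∷ w) then f (false ∷ v) else 0#))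
      ≈⟨ ∑-cong (words n) (λ v → ≈-trans (reflexive (cong₂
           (λ b b′ → (if b then f (true ∷ v) else 0#) + (if b′ then f (false ∷ v) else 0#))
           (refines-true v w) (refines-false-true v w))) (+-identityʳ _)) ⟩
    ∑ (words n) (λ v → if refines v w then f (true ∷ v) else 0#)
      ≈⟨ ∑-refinements w (f ∘ (true ∷_)) ⟩
    refinementSum (f ∘ (true ∷_)) w ∎
    where n = length w
  ∑-refinements (false ∷ w) f = begin
    ∑ (words (suc n)) (λ v → if refines v (false ∷ w) then f v else 0#)
      ≈⟨ ∑-words-suc n _ ⟩
    ∑ (words n) (λ v → (if refines (true ∷ v) (false ∷ w) then f (true ∷ v) else 0#) +
                       (if refines (false ∷ v) (false ∷ w) then f (false ∷ v) else 0#))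
      ≈⟨ ∑-cong (words n) (λ v → reflexive (cong₂
           (λ b b′ → (if b then f (true ∷ v) else 0#) + (if b′ then f (false ∷ v) else 0#))
           (refines-false true v w) (refines-false false v w))) ⟩
    ∑ (words n) (λ v → (if refines v w then f (true ∷ v) else 0#) +
                       (if refines v w then f (false ∷ v) else 0#))
      ≈⟨ ∑-+ (words n) _ _ ⟩
    ∑ (words n) (λ v → if refines v w then f (true ∷ v) else 0#) +
    ∑ (words n) (λ v → if refines v w then f (false ∷ v) else 0#)
      ≈⟨ +-cong (∑-refinements w (f ∘ (true ∷_))) (∑-refinements w (f ∘ (false ∷_))) ⟩
    refinementSum f (false ∷ w) ∎
    where n = length w

  _≟ʷ_ : (v w : List Bool) → Dec (v ≡ w)
  _≟ʷ_ = List.≡-dec Bool._≟_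

  ∑-words-indicator : ∀ w (f : List Bool → Carrier) →
    ∑ (words (length w)) (λ v → (if does (v ≟ʷ w) then 1# else 0#) * f v) ≈ f w
  ∑-words-indicator []      f = ≈-trans (+-identityʳ _) (*-identityˡ _)
  ∑-words-indicator (x ∷ w) f = ≈-trans (∑-words-suc (length w) _)
    (≈-trans (∑-cong (words (length w)) (step x)) (∑-words-indicator w (f ∘ (x ∷_))))
    where
    step : ∀ x v → (if does ((true ∷ v) ≟ʷ (x ∷ w)) then 1# else 0#) * f (true ∷ v) +
                   (if does ((false ∷ v) ≟ʷ (x ∷ w)) then 1# else 0#) * f (false ∷ v) ≈
                   (if does (v ≟ʷ w) then 1# else 0#) * f (x ∷ v)
    step true  v = ≈-trans (+-congˡ (zeroˡ _)) (+-identityʳ _)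
    step false v = ≈-trans (+-congʳ (zeroˡ _)) (+-identityˡ _)

  -- Functionals on the monomial and fundamental bases

  onF-∑ : ∀ (φ : Functional) α →
    φ ⟨ F α ⟩ ≈ ∑ (compositions (sum α)) (λ β → if does (β refines? α) then φ ⟨ M β ⟩ else 0#)
  onF-∑ φ α = ≈-trans (expand (filter (_refines? α) (compositions (sum α))))
    (∑-filter (_refines? α) (compositions (sum α)) _)
    where
    expand : ∀ βs → φ ⟨ foldr (λ β f → M β +ᑫ f) 0ᑫ βs ⟩ ≈ ∑ βs (λ β → φ ⟨ M β ⟩)
    expand []       = Functional.0ᴹ-homo φ
    expand (β ∷ βs) = ≈-trans (Functional.+ᴹ-homo φ (M β) _) (+-congˡ (expand βs))

  onM : Functional → List Bool → Carrier
  onM φ w = φ ⟨ M (ribbon w) ⟩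

  -- The first letter plays no role: it precedes the first box of the ribbon.
  onF : Functional → List Bool → Carrier
  onF φ []      = φ ⟨ F [] ⟩
  onF φ (_ ∷ w) = φ ⟨ F (ribbon w) ⟩

  F[]≈1 : F [] ≈ᑫ 1ᑫ
  F[]≈1 e = +-identityʳ (coeff 1ᑫ e)

  onF-[] : ∀ φ → onF φ [] ≈ φ ⟨ 1ᑫ ⟩
  onF-[] φ = Functional.⟦⟧-cong φ {F []} {1ᑫ} F[]≈1

  onF-refinementSum : ∀ φ x w → onF φ (x ∷ w) ≈ refinementSum (onM φ) w
  onF-refinementSum φ x w = begin
    φ ⟨ F (ribbon w) ⟩
      ≈⟨ onF-∑ φ (ribbon w) ⟩
    ∑ (compositions (sum (ribbon w))) (λ β → if does (β refines? ribbon w) then φ ⟨ M β ⟩ else 0#)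
      ≡⟨ cong (λ n → ∑ (compositions n) (λ β → if does (β refines? ribbon w) then φ ⟨ M β ⟩ else 0#))
           (sum-ribbon w) ⟩
    ∑ (compositions (suc (length w))) (λ β → if does (β refines? ribbon w) then φ ⟨ M β ⟩ else 0#)
      ≈⟨ ∑-compositions (length w) _ ⟩
    ∑ (words (length w)) (λ v → if refines v w then onM φ v else 0#)
      ≈⟨ ∑-refinements w (onM φ) ⟩
    refinementSum (onM φ) w ∎

  M-homogeneous : ∀ α → Homogeneous (sum α) (M α)
  M-homogeneous α e e≢ with nonzeros e ≟ᶜ α
  ... | yes eq = ⊥-elim (e≢ (≡.trans (≡.sym (sum-nonzeros e)) (cong sum eq)))
  ... | no  _  = ≈-refl

  F-homogeneous : ∀ α → Homogeneous (sum α) (F α)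
  F-homogeneous α e e≢ = ⟪ filter (_refines? α) (compositions (sum α)) ⟫
    (All.filter⁺ (_refines? α) (compositions-⊨ (sum α)))
    where
    ⟪_⟫ : ∀ βs → All (_⊨ sum α) βs → coeff (foldr (λ β f → M β +ᑫ f) 0ᑫ βs) e ≈ 0#
    ⟪ [] ⟫     []               = ≈-refl
    ⟪ β ∷ βs ⟫ ((_ , tot) ∷ ⊨s) = ≈-trans
      (+-cong (M-homogeneous β e (λ eq → e≢ (≡.trans eq tot))) (⟪ βs ⟫ ⊨s)) (+-identityˡ 0#)

  onF-cong : ∀ {φ ψ} → φ ≋ ψ → onF φ ≐ onF ψ
  onF-cong φ≋ψ []      = φ≋ψ (F [])
  onF-cong φ≋ψ (_ ∷ w) = φ≋ψ (F (ribbon w))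

  onF-bar : ∀ φ → onF (bar φ) ≐ twist (onF φ)
  onF-bar φ []      = bar-homogeneous φ 0 (F []) (F-homogeneous [])
  onF-bar φ (_ ∷ w) = bar-homogeneous φ (suc (length w)) (F (ribbon w))
    (subst (λ n → Homogeneous n (F (ribbon w))) (sum-ribbon w) (F-homogeneous (ribbon w)))

  onF-ε : onF ε ≐ δ
  onF-ε []      = +-identityʳ 1#
  onF-ε (_ ∷ w) = F-homogeneous (ribbon w) [] λ ()

  nonzeros-positive : ∀ {α} → All (0 ℕ.<_) α → nonzeros α ≡ α
  nonzeros-positive = List.filter-all (0 ℕ.<?_)

  M-coeff : ∀ v w → coeff (M (ribbon w)) (ribbon v) ≈ (if does (v ≟ʷ w) then 1# else 0#)
  M-coeff v w = reflexive (cong (λ b → if b then 1# else 0#) (≡.trans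
    (cong (λ β → does (β ≟ᶜ ribbon w)) (nonzeros-positive (proj₁ (ribbon-⊨ v))))
    (does-⇔ (mk⇔ (ribbon-injective v w) (cong ribbon)) (ribbon v ≟ᶜ ribbon w) (v ≟ʷ w))))

  module _ (ρ ψ : Functional) where
    open Expand ρ ψ using (layer; conv≈bound) renaming (onM to cutSum)

    -- `Δ` expands over all degrees up to the bound; homogeneity leaves the top degree, and there
    -- `M-coeff` leaves the single word w.
    ⋆-onM : ∀ w → onM (ρ ⋆ ψ) w ≈ cutSum (ribbon w)
    ⋆-onM w = begin
      Expand.conv ρ ψ (M α)
        ≈⟨ conv≈bound (M α) ⟩
      ∑ (upTo (suc (sum α))) (layer (M α))
        ≈⟨ ∑-last (sum α) (layer (M α)) (λ m m<N → ∑-zero (below m (ℕ.<⇒≢ m<N) (compositions-⊨ m))) ⟩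
      layer (M α) (sum α)
        ≡⟨ cong (layer (M α)) (sum-ribbon w) ⟩
      ∑ (compositions (suc (length w))) (λ β → coeff (M α) β * cutSum β)
        ≈⟨ ∑-compositions (length w) (λ β → coeff (M α) β * cutSum β) ⟩
      ∑ (words (length w)) (λ v → coeff (M α) (ribbon v) * cutSum (ribbon v))
        ≈⟨ ∑-cong (words (length w)) (λ v → *-congʳ {cutSum (ribbon v)} (M-coeff v w)) ⟩
      ∑ (words (length w)) (λ v → (if does (v ≟ʷ w) then 1# else 0#) * cutSum (ribbon v))
        ≈⟨ ∑-words-indicator w (λ v → cutSum (ribbon v)) ⟩
      cutSum α ∎
      where
      α = ribbon w
      below : ∀ m → ¬ (m ≡ sum α) → ∀ {βs} → All (_⊨ m) βs → All (λ β → coeff (M α) β * cutSum β ≈ 0#) βs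
      below m m≢ []                          = []
      below m m≢ {β ∷ _} ((_ , tot) ∷ ⊨s) = ≈-trans
        (*-congʳ (M-homogeneous α β (λ eq → m≢ (≡.trans (≡.sym tot) eq)))) (zeroˡ _) ∷ below m m≢ ⊨s

    ⋆-onM-[] : (ρ ⋆ ψ) ⟨ 1ᑫ ⟩ ≈ ρ ⟨ 1ᑫ ⟩ * ψ ⟨ 1ᑫ ⟩
    ⋆-onM-[] = ≈-trans (conv≈bound 1ᑫ)
      (≈-trans (+-identityʳ _) (≈-trans (+-identityʳ _) (≈-trans (*-identityˡ _) (+-identityʳ _))))

  ∑-cuts-∷ : ∀ a α k → ∑ (cuts (a ∷ α)) k ≈ k ([] , a ∷ α) + ∑ (cuts α) (λ (β , γ) → k (a ∷ β , γ))
  ∑-cuts-∷ a α k = +-congˡ (begin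
    ∑ (map cut (applyUpTo suc n)) k          ≡⟨ cong (λ is → ∑ (map cut is) k) (List.map-upTo suc n) ⟨
    ∑ (map cut (map suc (upTo n))) k         ≈⟨ ∑-map cut (map suc (upTo n)) k ⟩
    ∑ (map suc (upTo n)) (k ∘ cut)           ≈⟨ ∑-map suc (upTo n) (k ∘ cut) ⟩
    ∑ (upTo n) (k ∘ cut ∘ suc)               ≈⟨ ∑-map (λ i → take i α , drop i α) (upTo n)
                                                  (λ (β , γ) → k (a ∷ β , γ)) ⟨
    ∑ (cuts α) (λ (β , γ) → k (a ∷ β , γ))   ∎)
    where
    n = suc (length α)
    cut : ℕ → List ℕ × List ℕ
    cut i = take i (a ∷ α) , drop i (a ∷ α)

  -- Like conv, but only cutting at descents: the coproduct on the monomial basis.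
  convM : (f : List Bool → Carrier) (g₀ : Carrier) (g : List Bool → Carrier) → List Bool → Carrier
  convM f g₀ g []          = f [] * g₀
  convM f g₀ g (true  ∷ w) = f [] * g w + convM (f ∘ (true ∷_)) g₀ g w
  convM f g₀ g (false ∷ w) = convM (f ∘ (false ∷_)) g₀ g w

  ∑-cuts-remaining : ∀ (r s : List ℕ → Carrier) w →
    ∑ (cuts (remaining w)) (λ (β , γ) → r (suc (leading w) ∷ β) * s γ) ≈
    convM (r ∘ ribbon) (s []) (s ∘ ribbon) w
  ∑-cuts-remaining r s []          = +-identityʳ _
  ∑-cuts-remaining r s (true  ∷ w) = ≈-trans (∑-cuts-∷ _ (remaining w) _)
    (+-congˡ (∑-cuts-remaining (r ∘ (1 ∷_)) s w))
  ∑-cuts-remaining r s (false ∷ w) = ∑-cuts-remaining (r ∘ bump) s w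

  -- Puts the dummy letter in front, with `g₀` as the value in degree 0; this is how `onF` arises
  -- from `refinementSum (onM φ)`.
  extend : Carrier → (List Bool → Carrier) → List Bool → Carrier
  extend g₀ g []      = g₀
  extend g₀ g (_ ∷ w) = g w

  -- This turns cuts between parts into cuts before any box. A refinement can be cut at a letter
  -- once that letter is a descent, and every ascent of w can be refined to one; the letters on the
  -- two sides are then refined independently.
  refinementSum-convM : ∀ f g₀ g w → refinementSum (convM f g₀ g) w ≈ conv (refinementSum f) (extend g₀ (refinementSum g)) w
  refinementSum-convM f g₀ g []          = ≈-refl
  refinementSum-convM f g₀ g (true  ∷ w) = begin
    refinementSum (λ u → f [] * g u + convM (f ∘ (true ∷_)) g₀ g u) w
      ≈⟨ ≈-trans (refinementSum-+ _ _ w) (+-congʳ (refinementSum-* (f []) g w)) ⟩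
    f [] * refinementSum g w + refinementSum (convM (f ∘ (true ∷_)) g₀ g) w
      ≈⟨ +-congˡ (refinementSum-convM (f ∘ (true ∷_)) g₀ g w) ⟩
    f [] * refinementSum g w + conv (refinementSum (f ∘ (true ∷_))) (extend g₀ (refinementSum g)) w ∎
  refinementSum-convM f g₀ g (false ∷ w) = begin
    refinementSum (λ u → f [] * g u + convM (f ∘ (true ∷_)) g₀ g u) w +
      refinementSum (convM (f ∘ (false ∷_)) g₀ g) w
      ≈⟨ +-congʳ (≈-trans (refinementSum-+ _ _ w) (+-congʳ (refinementSum-* (f []) g w))) ⟩
    (f [] * refinementSum g w + refinementSum (convM (f ∘ (true ∷_)) g₀ g) w) +
      refinementSum (convM (f ∘ (false ∷_)) g₀ g) w
      ≈⟨ +-cong (+-congˡ (refinementSum-convM (f ∘ (true ∷_)) g₀ g w))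
                (refinementSum-convM (f ∘ (false ∷_)) g₀ g w) ⟩
    (f [] * refinementSum g w + conv (refinementSum (f ∘ (true ∷_))) g⁺ w) + conv (refinementSum (f ∘ (false ∷_))) g⁺ w
      ≈⟨ ≈-trans (+-assoc _ _ _) (+-congˡ (≈-sym (conv-+ _ _ g⁺ w))) ⟩
    f [] * refinementSum g w + conv (refinementSum f ∘ (false ∷_)) g⁺ w ∎
    where g⁺ = extend g₀ (refinementSum g)

  onF-⋆ : ∀ ρ ψ → onF (ρ ⋆ ψ) ≐ conv (onF ρ) (onF ψ)
  onF-⋆ ρ ψ []      = ≈-trans (onF-[] (ρ ⋆ ψ)) (≈-trans (⋆-onM-[] ρ ψ)
    (≈-sym (*-cong (onF-[] ρ) (onF-[] ψ))))
  onF-⋆ ρ ψ (x ∷ w) = begin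
    onF (ρ ⋆ ψ) (x ∷ w)
      ≈⟨ onF-refinementSum (ρ ⋆ ψ) x w ⟩
    refinementSum (onM (ρ ⋆ ψ)) w
      -- The cut with empty left piece is split off: in `convM` the left piece always contains the
      -- first part.
      ≈⟨ refinementSum-cong (λ u → ≈-trans (⋆-onM ρ ψ u) (≈-trans (∑-cuts-∷ _ (remaining u) _)
           (+-congˡ (∑-cuts-remaining (λ α → ρ ⟨ M α ⟩) (λ α → ψ ⟨ M α ⟩) u)))) w ⟩
    refinementSum (λ u → ρ ⟨ 1ᑫ ⟩ * onM ψ u + convM (onM ρ) (ψ ⟨ 1ᑫ ⟩) (onM ψ) u) w
      ≈⟨ ≈-trans (refinementSum-+ _ _ w) (+-cong (refinementSum-* _ _ w) (refinementSum-convM _ _ _ w)) ⟩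
    ρ ⟨ 1ᑫ ⟩ * refinementSum (onM ψ) w + conv (refinementSum (onM ρ)) (extend (ψ ⟨ 1ᑫ ⟩) (refinementSum (onM ψ))) w
      ≈⟨ +-cong (*-cong (≈-sym (onF-[] ρ)) (≈-sym (onF-refinementSum ψ x w)))
           (conv-cong (λ u → ≈-sym (onF-refinementSum ρ x u)) extend≐ w) ⟩
    conv (onF ρ) (onF ψ) (x ∷ w) ∎
    where
    extend≐ : extend (ψ ⟨ 1ᑫ ⟩) (refinementSum (onM ψ)) ≐ onF ψ
    extend≐ []      = ≈-sym (onF-[] ψ)
    extend≐ (y ∷ u) = ≈-sym (onF-refinementSum ψ y u)

  -- Return to the characters and the closed formulas

  onM-ζ : onM ζ ≐ [allAscents]
  onM-ζ w = begin
    ∑ (upTo (suc (sum (ribbon w)))) (λ m → coeff (M (ribbon w)) [ m ])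
      ≈⟨ ∑-last (sum (ribbon w)) _ (λ m m<N → M-homogeneous (ribbon w) [ m ]
           (λ eq → ℕ.<⇒≢ m<N (≡.trans (≡.sym (ℕ.+-identityʳ m)) eq))) ⟩
    (if does ([ sum (ribbon w) ] ≟ᶜ ribbon w) then 1# else 0#)
      ≈⟨ go w ⟩
    [allAscents] w ∎
    where
    go : ∀ w → (if does ([ sum (ribbon w) ] ≟ᶜ ribbon w) then 1# else 0#) ≈ [allAscents] w
    go []          = ≈-refl
    go (true  ∷ w) = reflexive (cong (λ b → if b then 1# else 0#)
      (dec-false ([ sum (ribbon (true ∷ w)) ] ≟ᶜ ribbon (true ∷ w)) λ ()))
    go (false ∷ w) = ≈-trans (reflexive (cong (λ b → if b then 1# else 0#)
      (does-⇔ (mk⇔ (λ eq → cong unbump eq) (cong bump))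
         ([ sum (ribbon (false ∷ w)) ] ≟ᶜ ribbon (false ∷ w)) ([ sum (ribbon w) ] ≟ᶜ ribbon w)))) (go w)
      where
      unbump : List ℕ → List ℕ
      unbump []      = []
      unbump (a ∷ α) = ℕ.pred a ∷ α

  onF-ζ : onF ζ ≐ Z
  onF-ζ []      = ≈-trans (+-identityʳ _) (+-identityʳ 1#)
  onF-ζ (x ∷ w) = ≈-trans (onF-refinementSum ζ x w) (≈-trans (refinementSum-cong onM-ζ w) (go w))
    where
    go : ∀ w → refinementSum [allAscents] w ≈ [allAscents] w
    go []          = ≈-refl
    go (true  ∷ w) = refinementSum-0 w
    go (false ∷ w) = ≈-trans (+-cong (refinementSum-0 w) (go w)) (+-identityˡ _)

  onF-character : ∀ φ → IsCharacter φ → onF φ [] ≈ 1#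
  onF-character φ char = ≈-trans (onF-[] φ) (RingMorphisms.IsRingHomomorphism.1#-homo char)

  module _ {ζ⁻¹ ζ⁻¹₊ ζ⁻¹₋ : Functional} (inverse : IsInverse ζ ζ⁻¹)
           (factorization : IsEvenOddFactorization ζ⁻¹ ζ⁻¹₊ ζ⁻¹₋) where
    open IsEvenOddFactorization factorization

    parts : (onF ζ⁻¹₊ ≐ Γ₊) × (twist (onF ζ⁻¹₋) ≐ Γ)
    parts = even-odd-parts {onF ζ⁻¹}
      (λ w → ≈-trans (conv-congˡ (λ u → ≈-sym (onF-ζ u)) w) (invert ζ ζ⁻¹ (proj₁ inverse) w))
      (λ w → ≈-trans (conv-congʳ {onF ζ⁻¹} (λ u → ≈-sym (onF-ζ u)) w) (invert ζ⁻¹ ζ (proj₂ inverse) w))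
      (onF-character ζ⁻¹₊ φ₊-character) (onF-character ζ⁻¹₋ φ₋-character)
      (λ w → ≈-trans (onF-cong {ζ⁻¹} {ζ⁻¹₊ ⋆ ζ⁻¹₋} factors w) (onF-⋆ ζ⁻¹₊ ζ⁻¹₋ w))
      (λ w → ≈-trans (≈-sym (onF-bar ζ⁻¹₊ w)) (onF-cong {bar ζ⁻¹₊} {ζ⁻¹₊} φ₊-even w))
      (λ w → ≈-trans (conv-congʳ {onF ζ⁻¹₋} (λ u → ≈-sym (onF-bar ζ⁻¹₋ u)) w)
                     (invert ζ⁻¹₋ (bar ζ⁻¹₋) (proj₁ φ₋-odd) w))
      where
      invert : ∀ ρ ψ → ρ ⋆ ψ ≋ ε → conv (onF ρ) (onF ψ) ≐ δ
      invert ρ ψ ρψ≋ε w = ≈-trans (≈-sym (onF-⋆ ρ ψ w))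
        (≈-trans (onF-cong {ρ ⋆ ψ} {ε} ρψ≋ε w) (onF-ε w))

    odd-part : ∀ w → let n = suc (length w) ; p = countDA false w in
      ζ⁻¹₋ ⟨ F (ribbon w) ⟩ ≈ [-1]^ (n ℕ.+ p) * ι (C p (⌊ n /2⌋ ∸ p)) /2^ (2 ℕ.* ⌊ n /2⌋)
    odd-part w = begin
      onF ζ⁻¹₋ (true ∷ w)
        ≈⟨ twist-involutive (onF ζ⁻¹₋) (true ∷ w) ⟨
      [-1]^ n * twist (onF ζ⁻¹₋) (true ∷ w)
        ≈⟨ *-congˡ (proj₂ parts (true ∷ w)) ⟩
      [-1]^ n * γ p n
        ≈⟨ *-congˡ (γ-closed p n (≤⌊/2⌋ (ℕ.m≤n⇒m≤1+n (2*countDA-false≤ w)))) ⟩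
      [-1]^ n * ([-1]^ p * x * y)
        ≈⟨ solve 4 (λ s t x y → s :* (t :* x :* y) := s :* t :* x :* y) ≈-refl ([-1]^ n) ([-1]^ p) x y ⟩
      [-1]^ n * [-1]^ p * x * y
        ≈⟨ *-congʳ (*-congʳ (^-homo-* (- 1#) n p)) ⟨
      [-1]^ (n ℕ.+ p) * x * y ∎
      where
      n = suc (length w)
      p = countDA false w
      x = ι (C p (⌊ n /2⌋ ∸ p))
      y = ½ ^ (2 ℕ.* ⌊ n /2⌋)

    even-part : ∀ w → let n = suc (length w) ; q = countDA true w in even? n ≡ true →
      ζ⁻¹₊ ⟨ F (ribbon w) ⟩ ≈ [-1]^ q * ι (C q (⌊ n /2⌋ ∸ q)) /2^ n
    even-part w even = begin
      onF ζ⁻¹₊ (true ∷ w)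
        ≈⟨ proj₁ parts (true ∷ w) ⟩
      γ-evenPart q n
        ≡⟨ cong (λ b → if b then γ q n else 0#) even ⟩
      γ q n
        ≈⟨ γ-closed q n (≤⌊/2⌋ (2*countDA-true≤ w)) ⟩
      [-1]^ q * ι (C q (⌊ n /2⌋ ∸ q)) /2^ (2 ℕ.* ⌊ n /2⌋)
        ≡⟨ cong ([-1]^ q * ι (C q (⌊ n /2⌋ ∸ q)) /2^_) (2*⌊n/2⌋≡n n even) ⟩
      [-1]^ q * ι (C q (⌊ n /2⌋ ∸ q)) /2^ n ∎
      where
      n = suc (length w)
      q = countDA true w

    even-part-0 : ∀ w → even? (suc (length w)) ≡ false → ζ⁻¹₊ ⟨ F (ribbon w) ⟩ ≈ 0#
    even-part-0 w odd = ≈-trans (proj₁ parts (true ∷ w))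
      (reflexive (cong (λ b → if b then γ (countDA true w) (suc (length w)) else 0#) odd))

theorem8p7 : ∀ {c ℓ₁ ℓ₂} (K : HeytingField c ℓ₁ ℓ₂) (2#0 : CharNot2 K) →
    let open QuasiSymmetric K 2#0 in
    (ζ⁻¹ ζ⁻¹₊ ζ⁻¹₋ : Functional) →
    IsCharacter ζ⁻¹ → IsInverse ζ ζ⁻¹ →
    IsEvenOddFactorization ζ⁻¹ ζ⁻¹₊ ζ⁻¹₋ →
    (n : ℕ) (α : List ℕ) → α ⊨ n →
    let p = p₋ (reverse α)
        q = p₊ (conjugate n α)
    in (ζ⁻¹₋ ⟨ F α ⟩ ≈ [-1]^ (n ℕ.+ p) * ι (C p (⌊ n /2⌋ ∸ p)) /2^ (2 ℕ.* ⌊ n /2⌋))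
       × (2 ∣ n → ζ⁻¹₊ ⟨ F α ⟩ ≈ [-1]^ q * ι (C q (⌊ n /2⌋ ∸ q)) /2^ n)
       × (¬ (2 ∣ n) → ζ⁻¹₊ ⟨ F α ⟩ ≈ 0#)
-- The empty composition is not a ribbon of a word. Characters take the value 1 there, and so do the
-- formulas, as C(0, 0) = 1.
theorem8p7 K 2#0 ζ⁻¹ ζ⁻¹₊ ζ⁻¹₋ _ inverse factorization zero [] _ =
  ≈-trans (onF-character ζ⁻¹₋ φ₋-character) one ,
  (λ _ → ≈-trans (onF-character ζ⁻¹₊ φ₊-character) one) ,
  (λ 2∤0 → ⊥-elim (2∤0 (divides 0 refl)))
  where
  open QuasiSymmetric K 2#0
  open CommutativeRing 𝕜 using () renaming (sym to ≈-sym; trans to ≈-trans)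
  open IsEvenOddFactorization factorization
  open Parts K 2#0
  one : 1# ≈ 1# * (1# + 0#) * 1#
  one = ≈-sym (≈-trans (*-identityʳ _) (≈-trans (*-identityˡ _) (+-identityʳ 1#)))
theorem8p7 K 2#0 ζ⁻¹ ζ⁻¹₊ ζ⁻¹₋ _ inverse factorization zero (suc _ ∷ _) (_ , ())
theorem8p7 K 2#0 ζ⁻¹ ζ⁻¹₊ ζ⁻¹₋ _ inverse factorization zero (zero ∷ _) (() ∷ _ , _)
theorem8p7 K 2#0 ζ⁻¹ ζ⁻¹₊ ζ⁻¹₋ _ inverse factorization (suc m) α α⊨n
  with w , refl , refl ← ribbon-surjective α⊨n
  rewrite p₋-reverse w | p₊-conjugate w =
  odd-part inverse factorization w ,
  (λ 2∣n → even-part inverse factorization w (2∣⇒even? (suc (length w)) 2∣n)) ,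
  (λ 2∤n → even-part-0 inverse factorization w (2∤⇒even? (suc (length w)) 2∤n))
  where open Parts K 2#0
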